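{- Let $\mathcal{P}\subseteq\mathbb{R}^n_{\ge0}$ be a fixed polytope and let $\mathcal{A}$ be an $(\alpha,\beta)$-approximation face-preserving rounding algorithm for unweighted $(Q^{\mathcal{P}})$. Then one can obtain a $(1,\alpha\beta)$-approximation algorithm for $(Q^{\mathcal{P}})$ using a single call to $\mathcal{A}$.
   Context: Problem $(Q^{\mathcal{P}})$: given $c\in\mathbb{R}^n_{\ge0}$, $A\in\mathbb{R}^{m\times n}_{\ge0}$ with rows $A_1,\dots,A_m$, and $b\in\mathbb{R}^m_{\ge0}$, find $\min c^\intercal x$ subject to $x$ being an extreme point of $\mathcal{P}$ and $Ax\le b$. For $\lambda\ge1$, $(R^{\mathcal{P}}_\lambda)$ is the LP $\min\{c^\intercal x: x\in\mathcal{P},\ Ax\le\lambda b\}$ with optimal value $\mathrm{OPT}^{\mathcal{P}}(\lambda)$; $\mathrm{OPT}^{\mathcal{P}}=\mathrm{OPT}^{\mathcal{P}}(1)$. An algorithm $\mathcal{A}$ is an $(\alpha,\beta)$-approximation FPRA for unweighted $(Q^{\mathcal{P}})$ if given any $x\in\mathcal{P}$ it finds in polynomial time an extreme point $\hat x$ of $\mathcal{P}$ such that (P1) $\hat x$ lies in the minimal face of $\mathcal{P}$ containing $x$, (P2) $A\hat x\le\beta Ax$, and (P3) whenever $x$ is feasible for $(R^{\mathcal{P}}_\alpha)$, $A_i^\intercal\hat x\ge\frac{A_i^\intercal x}{\alpha}$ for every $i$ with $A_i^\intercal x=\alpha b_i$. A $(\rho_1,\rho_2)$-approximation algorithm for $(Q^{\mathcal{P}})$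 finds in polynomial time an extreme point $\hat x$ of $\mathcal{P}$ with $c^\intercal\hat x\le\rho_1\mathrm{OPT}^{\mathcal{P}}$ and $A\hat x\le\rho_2b$. -}

module Defs where

open import Level using (Level; _⊔_) renaming (suc to lsuc)
open import Algebra.Bundles using (CommutativeRing)
open import Algebra.Structures using (IsCommutativeRing)
open import Data.Bool.Base using (Bool; true; false)
open import Data.Empty.Polymorphic using (⊥)
open import Data.Fin.Base using (Fin)
open import Data.List.Base using (List; []; _∷_; _++_; [_]; length; tabulate; concat)
open import Data.Nat.Base as ℕ using (ℕ)
import Data.Nat.Properties as ℕ
open import Data.Product.Base using (Σ-syntax; ∃; ∃-syntax; _×_)
open import Data.Vec.Functional using (Vector)
open import Relation.Binary.PropositionalEquality.Core using (_≡_; _≢_)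
open import Relation.Binary.Structures using (IsDecTotalOrder)
open import Relation.Nullary.Decidable.Core using (yes; no; does)

------------------------------------------------------------------------
-- Ordered fields

-- The real numbers enter only through this interface. As order and
-- equality are decidable (the comparisons of an algorithm with real
-- inputs need this), ℚ is an instance constructively and ℝ is one
-- classically.

record OrderedField (a ℓ : Level) : Set (lsuc (a ⊔ ℓ)) where
  infixl 6 _+_
  infixl 7 _*_
  infix  8 -_
  infix  9 _⁻¹
  infix  4 _≤_ _<_
  field
    Carrier           : Set a
    _+_ _*_           : Carrier → Carrier → Carrier
    -_                : Carrier → Carrier
    0# 1#             : Carrier
    _⁻¹               : Carrier → Carrier      -- 0# ⁻¹ is unspecified
    _≤_               : Carrier → Carrier → Set ℓ
    isCommutativeRing : IsCommutativeRing _≡_ _+_ _*_ -_ 0# 1#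
    0≢1               : 0# ≢ 1#
    ⁻¹-inverseʳ       : ∀ x → x ≢ 0# → x * x ⁻¹ ≡ 1#
    isDecTotalOrder   : IsDecTotalOrder _≡_ _≤_
    +-monoʳ-≤         : ∀ x {y z} → y ≤ z → x + y ≤ x + z
    *-nonNeg          : ∀ {x y} → 0# ≤ x → 0# ≤ y → 0# ≤ x * y

  open IsDecTotalOrder isDecTotalOrder public using (_≤?_; _≟_)

  commutativeRing : CommutativeRing a a
  commutativeRing = record { isCommutativeRing = isCommutativeRing }

  _<_ : Carrier → Carrier → Set (a ⊔ ℓ)
  x < y = x ≤ y × x ≢ y

------------------------------------------------------------------------

module Over {a ℓ} (F : OrderedField a ℓ) where

  open OrderedField F renaming (Carrier to K)
  open CommutativeRing commutativeRing using (_-_; +-rawMonoid)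
  open import Algebra.Definitions.RawMonoid +-rawMonoid using (sum)

  infix 7 _·_
  _·_ : ∀ {n} → Vector K n → Vector K n → K
  x · y = sum (λ j → x j * y j)

  NonNeg : ∀ {n} → Vector K n → Set ℓ
  NonNeg x = ∀ j → 0# ≤ x j

  ----------------------------------------------------------------------
  -- Polytopes

  -- The convex hull of finitely many (possibly no) points.
  record Polytope (n : ℕ) : Set a where
    field
      size      : ℕ
      generator : Fin size → Vector K n

  infix 4 _∈_
  _∈_ : ∀ {n} → Vector K n → Polytope n → Set (a ⊔ ℓ)
  x ∈ P = ∃[ w ] NonNeg w × sum w ≡ 1# × (∀ j → x j ≡ sum (λ i → w i * generator i j))
    where open Polytope P

  Extreme : ∀ {n} → Polytope n → Vector K n → Set (a ⊔ ℓ)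
  Extreme P x = x ∈ P ×
    (∀ y z → y ∈ P → z ∈ P → ∀ t → 0# < t → t < 1# →
      (∀ j → x j ≡ t * y j + (1# - t) * z j) → ∀ j → y j ≡ x j × z j ≡ x j)

  -- The face of P cut out by the valid inequality normal · y ≤ offset.
  record Face {n} (P : Polytope n) : Set (a ⊔ ℓ) where
    field
      normal : Vector K n
      offset : K
      valid  : ∀ y → y ∈ P → normal · y ≤ offset

  infix 4 _∈ᶠ_
  _∈ᶠ_ : ∀ {n} {P : Polytope n} → Vector K n → Face P → Set (a ⊔ ℓ)
  _∈ᶠ_ {P = P} y G = y ∈ P × normal · y ≡ offset
    where open Face G

  IsMinimalFace : ∀ {n} {P : Polytope n} → Vector K n → Face P → Set (a ⊔ ℓ)
  IsMinimalFace {P = P} x G = x ∈ᶠ G ×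
    (∀ (H : Face P) → x ∈ᶠ H → ∀ y → y ∈ᶠ G → y ∈ᶠ H)

  InMinimalFace : ∀ {n} → Polytope n → Vector K n → Vector K n → Set (a ⊔ ℓ)
  InMinimalFace P x y = Σ[ G ∈ Face P ] (IsMinimalFace x G × y ∈ᶠ G)

  ----------------------------------------------------------------------
  -- Instances and the linear programs

  record UnweightedInstance (n : ℕ) : Set (a ⊔ ℓ) where
    field
      m        : ℕ
      A        : Fin m → Vector K n
      b        : Vector K m
      A-nonNeg : ∀ i → NonNeg (A i)
      b-nonNeg : NonNeg b

  record Instance (n : ℕ) : Set (a ⊔ ℓ) where
    field
      unweighted : UnweightedInstance n
      cost       : Vector K n
      c-nonNeg   : NonNeg cost
    open UnweightedInstance unweighted public

  Feasible : ∀ {n} → Polytope n → UnweightedInstance n → K → Vector K n → Set (a ⊔ ℓ)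
  Feasible P I lam x = x ∈ P × (∀ i → A i · x ≤ lam * b i)
    where open UnweightedInstance I

  -- v is the optimal value of min { cost · x : x ∈ P, A x ≤ lam b }.
  IsOPT : ∀ {n} → Polytope n → Instance n → K → K → Set (a ⊔ ℓ)
  IsOPT P I lam v =
    (∃[ x ] Feasible P unweighted lam x × cost · x ≡ v) ×
    (∀ y → Feasible P unweighted lam y → v ≤ cost · y)
    where open Instance I

  ----------------------------------------------------------------------
  -- Algorithms

  -- Blum–Shub–Smale-style computation: while programs over stacks of
  -- field elements, where an arithmetic operation or a comparison has
  -- unit cost. A single finite program handles inputs of every length.

  Register : Set
  Register = ℕ

  data Op : Set where
    add sub mul div : Op

  data Test : Set where
    nonEmpty : Register → Test
    leq      : Register → Register → Test

  infixr 5 _⨾_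
  data Program : Set a where
    skip          : Program
    _⨾_           : Program → Program → Program
    push          : Register → K → Program
    drop          : Register → Program
    copy          : Register → Register → Program
    arith         : Op → Register → Register → Register → Program
    if_then_else_ : Test → Program → Program → Program
    while_loop_   : Test → Program → Program
    call          : Register → Register → Program

  Store : Set a
  Store = Register → List K

  _[_≔_] : Store → Register → List K → Store
  (σ [ r ≔ xs ]) s with r ℕ.≟ s
  ... | yes _ = xs
  ... | no  _ = σ s

  data ⟦_⟧_,_↦_ : Op → K → K → K → Set a where
    add : ∀ {x y} → ⟦ add ⟧ x , y ↦ (x + y)
    sub : ∀ {x y} → ⟦ sub ⟧ x , y ↦ (x - y)
    mul : ∀ {x y} → ⟦ mul ⟧ x , y ↦ (x * y)
    div : ∀ {x y} → y ≢ 0# → ⟦ div ⟧ x , y ↦ (x * y ⁻¹)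

  data Eval (σ : Store) : Test → Bool → Set a where
    empty : ∀ {r} → σ r ≡ [] → Eval σ (nonEmpty r) false
    cons  : ∀ {r x xs} → σ r ≡ x ∷ xs → Eval σ (nonEmpty r) true
    leq   : ∀ {r s x y xs ys} → σ r ≡ x ∷ xs → σ s ≡ y ∷ ys →
            Eval σ (leq r s) (does (x ≤? y))

  -- O xs ys t : on input xs the oracle answers ys after t steps.
  Oracle : Set (lsuc a)
  Oracle = List K → List K → ℕ → Set a

  -- Exec O p σ σ′ t k : started in σ, p halts in σ′ after t steps, which
  -- include those spent inside the oracle, having called it k times.
  -- A program that reads an empty stack or divides by zero is stuck.
  data Exec (O : Oracle) : Program → Store → Store → ℕ → ℕ → Set a where
    skip    : ∀ {σ} → Exec O skip σ σ 1 0
    seq     : ∀ {p q σ σ′ σ″ t t′ k k′} →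
              Exec O p σ σ′ t k → Exec O q σ′ σ″ t′ k′ →
              Exec O (p ⨾ q) σ σ″ (t ℕ.+ t′) (k ℕ.+ k′)
    push    : ∀ {r x σ} → Exec O (push r x) σ (σ [ r ≔ x ∷ σ r ]) 1 0
    drop    : ∀ {r x xs σ} → σ r ≡ x ∷ xs →
              Exec O (drop r) σ (σ [ r ≔ xs ]) 1 0
    copy    : ∀ {r s x xs σ} → σ r ≡ x ∷ xs →
              Exec O (copy r s) σ (σ [ s ≔ x ∷ σ s ]) 1 0
    arith   : ∀ {o r s u x y z xs ys σ} → σ r ≡ x ∷ xs → σ s ≡ y ∷ ys →
              ⟦ o ⟧ x , y ↦ z →
              Exec O (arith o r s u) σ (σ [ u ≔ z ∷ σ u ]) 1 0
    if-true  : ∀ {c p q σ σ′ t k} → Eval σ c true → Exec O p σ σ′ t k →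
              Exec O (if c then p else q) σ σ′ (1 ℕ.+ t) k
    if-false : ∀ {c p q σ σ′ t k} → Eval σ c false → Exec O q σ σ′ t k →
              Exec O (if c then p else q) σ σ′ (1 ℕ.+ t) k
    done    : ∀ {c p σ} → Eval σ c false →
              Exec O (while c loop p) σ σ 1 0
    iterate : ∀ {c p σ σ′ σ″ t t′ k k′} → Eval σ c true →
              Exec O p σ σ′ t k → Exec O (while c loop p) σ′ σ″ t′ k′ →
              Exec O (while c loop p) σ σ″ (1 ℕ.+ t ℕ.+ t′) (k ℕ.+ k′)
    -- Passing the input and receiving the answer costs their lengths.
    call    : ∀ {r s ys t σ} → O (σ r) ys t →
              Exec O (call r s) σ (σ [ s ≔ ys ])
                (1 ℕ.+ length (σ r) ℕ.+ t ℕ.+ length ys) 1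

  -- Register 0 holds the input at the start and the output at the end;
  -- all other registers start empty.
  Run : Oracle → Program → List K → List K → ℕ → ℕ → Set a
  Run O p xs ys t k =
    ∃[ σ ] Exec O p ((λ _ → []) [ 0 ≔ xs ]) σ t k × σ 0 ≡ ys

  -- With this oracle every call is stuck.
  noOracle : Oracle
  noOracle _ _ _ = ⊥

  asOracle : Program → Oracle
  asOracle p xs ys t = Run noOracle p xs ys t 0

  -- Every polynomial with natural coefficients is dominated by one of
  -- the form C s ^ d + C.
  polyBound : ℕ → ℕ → ℕ → ℕ
  polyBound C d s = C ℕ.* s ℕ.^ d ℕ.+ C

  -- A vector (the point to be rounded, or the cost vector) followed by
  -- the rows A₁ b₁ , … , A_m b_m. The size of an input is its length.
  encode : ∀ {n} → Vector K n → UnweightedInstance n → List K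
  encode x I = tabulate x ++ concat (tabulate λ i → tabulate (A i) ++ [ b i ])
    where open UnweightedInstance I

  ----------------------------------------------------------------------
  -- Face-preserving rounding and approximation algorithms

  record IsRounding {n} (P : Polytope n) (α β : K) (I : UnweightedInstance n)
                    (x x̂ : Vector K n) : Set (a ⊔ ℓ) where
    open UnweightedInstance I
    field
      extreme : Extreme P x̂
      P1      : InMinimalFace P x x̂
      P2      : ∀ i → A i · x̂ ≤ β * (A i · x)
      P3      : Feasible P I α x →
                ∀ i → A i · x ≡ α * b i → (A i · x) * α ⁻¹ ≤ A i · x̂

  IsFPRA : ∀ {n} → Polytope n → K → K → Program → Set (a ⊔ ℓ)
  IsFPRA {n} P α β p = ∃[ C ] ∃[ d ]
    ∀ (I : UnweightedInstance n) (x : Vector K n) → x ∈ P →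
    ∃[ x̂ ] ∃[ t ]
      Run noOracle p (encode x I) (tabulate x̂) t 0 ×
      t ℕ.≤ polyBound C d (length (encode x I)) ×
      IsRounding P α β I x x̂

  record IsApproximation {n} (P : Polytope n) (ρ₁ ρ₂ : K) (I : Instance n)
                         (x̂ : Vector K n) : Set (a ⊔ ℓ) where
    open Instance I
    field
      extreme  : Extreme P x̂
      cost≤    : ∀ v → IsOPT P I 1# v → cost · x̂ ≤ ρ₁ * v
      budget   : ∀ i → A i · x̂ ≤ ρ₂ * b i

  -- p is a (ρ₁ , ρ₂)-approximation algorithm making a single call to q.
  -- It halts in polynomial time on every instance; when the linear
  -- program defining OPT is infeasible there is no requirement on its
  -- output, and it may then also halt without calling q.
  IsSingleCallApproximationAlgorithm :
    ∀ {n} → Polytope n → K → K → (q p : Program) → Set (a ⊔ ℓ)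
  IsSingleCallApproximationAlgorithm {n} P ρ₁ ρ₂ q p = ∃[ C ] ∃[ d ]
    ∀ (I : Instance n) → let open Instance I; input = encode cost unweighted in
    ∃[ out ] ∃[ t ] ∃[ k ]
      Run (asOracle q) p input out t k ×
      t ℕ.≤ polyBound C d (length input) ×
      k ℕ.≤ 1 ×
      (∃ (Feasible P unweighted 1#) →
        k ≡ 1 × (∃[ x̂ ] out ≡ tabulate x̂ × IsApproximation P ρ₁ ρ₂ I x̂))

{-# OPTIONS --safe #-}

-- Round an optimal point x of the relaxation with budgets α b. Since the
-- rounded point x̂ lies in the minimal face of x, the point x + ε (x − x̂) stays
-- in the polytope for small ε, and so does z = (x + ε (x − x̂) + ε y) / (1 + ε)
-- for every y that is feasible for the budgets b. On a budget that is tight at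
-- x, property P3 bounds A x̂ from below by A y, so that z respects α b; the
-- slack of the other budgets absorbs a small ε. Optimality of x then reads
-- c x̂ ≤ c y, and P2 gives A x̂ ≤ β A x ≤ α β b.
--
-- The optimal x is computed by Fourier–Motzkin elimination over the weights of
-- the generators of the polytope: their number is fixed, so the repeated
-- squaring of the number of constraints stays polynomial.
module Submission where

open import Defs
open import Algebra.Bundles using (CommutativeRing)
open import Data.Bool.Base using (true; false)
open import Data.Empty using (⊥; ⊥-elim)
open import Data.Fin.Base using (Fin; zero; suc; toℕ)
open import Data.Integer.Base as ℤ using (ℤ; -[1+_]) renaming (+_ to posℤ)
import Data.Integer.Properties as ℤ
open import Data.List.Base as List
  using (List; []; _∷_; _++_; _ʳ++_; length; reverse; tabulate; concat; concatMap; map; filter; cartesianProductWith)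
open import Data.List.Membership.Propositional renaming (_∈_ to _∈ₗ_)
open import Data.List.Membership.Propositional.Properties
  using (∈-map⁺; ∈-map⁻; ∈-++⁺ˡ; ∈-++⁺ʳ; ∈-++⁻; ∈-tabulate⁺; ∈-tabulate⁻; ∈-filter⁺; ∈-filter⁻; ∈-cartesianProductWith⁺; ∈-cartesianProductWith⁻)
open import Data.List.Properties
  using (++-ʳ++; ʳ++-ʳ++; ++-identityʳ; filter-accept; filter-reject; filter-none; length-++; length-tabulate; length-ʳ++; length-filter; length-map; length-reverse; map-tabulate; tabulate-cong)
import Data.List.Relation.Unary.All as All
open import Data.List.Relation.Unary.Any using (here; there)
open import Data.List.Relation.Unary.Any.Properties using (reverse⁺; reverse⁻)
import Data.Maybe.Base as Maybe
open import Data.Nat.Base as ℕ using (ℕ; zero; suc; z≤n; s≤s)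
import Data.Nat.DivMod as ℕ
import Data.Nat.Properties as ℕ
open import Data.Product.Base using (∃; ∃-syntax; _×_; _,_; proj₁; proj₂)
open import Data.Sum.Base using (_⊎_; inj₁; inj₂; [_,_]′; map₂)
open import Data.Unit.Base using (⊤; tt)
open import Data.Vec.Functional using (Vector; head; tail) renaming (_∷_ to _◂_)
open import Function.Base using (_∘_; id)
open import Level using (_⊔_)
open import Relation.Binary.Consequences using (dec⇒weaklyDec)
open import Relation.Binary.PropositionalEquality hiding (J)
open import Relation.Binary.Structures using (IsDecTotalOrder)
open import Relation.Nullary using (¬_; yes; no; ¬?)

-- Ordered fields

-- Faces are cut out by valid inequalities, whereas the polytope is given by generators. Farkas'
-- lemma bridges the two: that x̂ lies in the minimal face of x becomes the identity x̂ + Σ μᵢ gᵢ =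
-- (1 + Σ μᵢ) x with μ ≥ 0. The small ε then turns into an explicit multiplier M in the role of 1/ε,
-- which may also be zero, and no limiting argument occurs. The machine is charged per field
-- operation and inputs have no bit length, so an LP method whose cost depends on bit lengths is out
-- of reach; elimination in fixed dimension depends on the number of constraints alone. Elimination
-- by itself only decides feasibility. The objective enters as an extra last variable: it is
-- eliminated last, hence chosen first in the back-substitution, and as large as possible. Keeping
-- all variables nonpositive gives each of them an upper bound, so the back-substitution can always
-- take the least upper bound and never meets an unbounded variable.

module FieldProperties {a ℓ} (F : OrderedField a ℓ) where

  open OrderedField F renaming (Carrier to K)
  open Over F using (_·_; NonNeg)
  open CommutativeRing commutativeRing public
    using (_-_; +-comm; +-assoc; +-identityˡ; +-identityʳ; *-comm; *-assoc; *-identityˡ; *-identityʳ;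
           zeroˡ; zeroʳ; -‿inverseʳ; -‿inverseˡ; distribˡ; ring; semiring)
  open IsDecTotalOrder isDecTotalOrder public
    using () renaming (refl to ≤-refl; trans to ≤-trans; reflexive to ≤-reflexive;
                       antisym to ≤-antisym; total to ≤-total)
  open import Algebra.Properties.Ring ring using (-‿distribˡ-*; -‿distribʳ-*; -‿involutive; -‿+-comm; -0#≈0#)
  open import Algebra.Properties.Semiring.Sum semiring public
    using (sum; sum-cong-≗; ∑-distrib-+; ∑-comm; *-distribˡ-sum; *-distribʳ-sum)
  open ≡-Reasoning

  -- The field is abstract, so its own equality test does not reduce on constants. Integer
  -- coefficients do reduce, and the optimised multiples make `⟦_⟧` send 0 and 1 to `0#` and `1#`
  -- definitionally.
  module RingSolver where
    open import Algebra.Properties.Semiring.Mult.TCOptimised semiring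
      using (1+×; ×1-homo-*) renaming (_×_ to _⋆_; ×-homo-+ to ⋆-homo-+)
    open import Algebra.Solver.Ring.AlmostCommutativeRing
      using (fromCommutativeRing; _-Raw-AlmostCommutative⟶_)

    ⟦_⟧ : ℤ → K
    ⟦ posℤ n ⟧      = n ⋆ 1#
    ⟦ -[1+ n ] ⟧ = - (suc n ⋆ 1#)

    cancel : ∀ x y z → x + y - (x + z) ≡ y - z
    cancel x y z = begin
      x + y - (x + z)       ≡⟨ cong₂ _+_ (+-comm x y) (sym (-‿+-comm x z)) ⟩
      y + x + (- x - z)     ≡⟨ +-assoc y x _ ⟩
      y + (x + (- x - z))   ≡⟨ cong (y +_) (sym (+-assoc x (- x) (- z))) ⟩
      y + (x - x - z)       ≡⟨ cong (λ w → y + (w - z)) (-‿inverseʳ x) ⟩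
      y + (0# - z)          ≡⟨ cong (y +_) (+-identityˡ _) ⟩
      y - z                 ∎

    ⟦⟧-⊖ : ∀ m n → ⟦ m ℤ.⊖ n ⟧ ≡ m ⋆ 1# - n ⋆ 1#
    ⟦⟧-⊖ zero    zero    = sym (-‿inverseʳ 0#)
    ⟦⟧-⊖ zero    (suc n) = sym (+-identityˡ _)
    ⟦⟧-⊖ (suc m) zero    = sym (trans (cong (suc m ⋆ 1# +_) -0#≈0#) (+-identityʳ _))
    ⟦⟧-⊖ (suc m) (suc n) = begin
      ⟦ suc m ℤ.⊖ suc n ⟧                 ≡⟨ cong ⟦_⟧ (ℤ.[1+m]⊖[1+n]≡m⊖n m n) ⟩
      ⟦ m ℤ.⊖ n ⟧                         ≡⟨ ⟦⟧-⊖ m n ⟩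
      m ⋆ 1# - n ⋆ 1#                     ≡⟨ cancel 1# (m ⋆ 1#) (n ⋆ 1#) ⟨
      1# + m ⋆ 1# - (1# + n ⋆ 1#)         ≡⟨ cong₂ _-_ (1+× m 1#) (1+× n 1#) ⟨
      suc m ⋆ 1# - suc n ⋆ 1#             ∎

    ⟦⟧-neg : ∀ i → ⟦ ℤ.- i ⟧ ≡ - ⟦ i ⟧
    ⟦⟧-neg (posℤ zero)   = sym -0#≈0#
    ⟦⟧-neg (posℤ (suc n))  = refl
    ⟦⟧-neg (-[1+ n ]) = sym (-‿involutive _)

    ⟦⟧-+ : ∀ i j → ⟦ i ℤ.+ j ⟧ ≡ ⟦ i ⟧ + ⟦ j ⟧
    ⟦⟧-+ (posℤ m)      (posℤ n)      = ⋆-homo-+ 1# m n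
    ⟦⟧-+ (posℤ m)      (-[1+ n ]) = ⟦⟧-⊖ m (suc n)
    ⟦⟧-+ (-[1+ m ]) (posℤ n)      = trans (⟦⟧-⊖ n (suc m)) (+-comm _ _)
    ⟦⟧-+ (-[1+ m ]) (-[1+ n ]) = begin
      - (suc (suc (m ℕ.+ n)) ⋆ 1#)        ≡⟨ cong (λ k → - (suc k ⋆ 1#)) (ℕ.+-suc m n) ⟨
      - ((suc m ℕ.+ suc n) ⋆ 1#)          ≡⟨ cong -_ (⋆-homo-+ 1# (suc m) (suc n)) ⟩
      - (suc m ⋆ 1# + suc n ⋆ 1#)         ≡⟨ -‿+-comm _ _ ⟨
      - (suc m ⋆ 1#) - suc n ⋆ 1#         ∎

    ⟦⟧-*⁺ : ∀ m j → ⟦ posℤ m ℤ.* j ⟧ ≡ m ⋆ 1# * ⟦ j ⟧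
    ⟦⟧-*⁺ m (posℤ n) = trans (cong ⟦_⟧ (sym (ℤ.pos-* m n))) (×1-homo-* m n)
    ⟦⟧-*⁺ m (-[1+ n ]) = begin
      ⟦ posℤ m ℤ.* (-[1+ n ]) ⟧        ≡⟨ cong ⟦_⟧ (ℤ.neg-distribʳ-* (posℤ m) (posℤ (suc n))) ⟨
      ⟦ ℤ.- (posℤ m ℤ.* posℤ (suc n)) ⟧     ≡⟨ ⟦⟧-neg (posℤ m ℤ.* posℤ (suc n)) ⟩
      - ⟦ posℤ m ℤ.* posℤ (suc n) ⟧         ≡⟨ cong -_ (⟦⟧-*⁺ m (posℤ (suc n))) ⟩
      - (m ⋆ 1# * (suc n ⋆ 1#))     ≡⟨ -‿distribʳ-* _ _ ⟩
      m ⋆ 1# * ⟦ -[1+ n ] ⟧         ∎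

    ⟦⟧-* : ∀ i j → ⟦ i ℤ.* j ⟧ ≡ ⟦ i ⟧ * ⟦ j ⟧
    ⟦⟧-* (posℤ m)      j = ⟦⟧-*⁺ m j
    ⟦⟧-* (-[1+ m ]) j = begin
      ⟦ -[1+ m ] ℤ.* j ⟧            ≡⟨ cong ⟦_⟧ (ℤ.neg-distribˡ-* (posℤ (suc m)) j) ⟨
      ⟦ ℤ.- (posℤ (suc m) ℤ.* j) ⟧       ≡⟨ ⟦⟧-neg (posℤ (suc m) ℤ.* j) ⟩
      - ⟦ posℤ (suc m) ℤ.* j ⟧           ≡⟨ cong -_ (⟦⟧-*⁺ (suc m) j) ⟩
      - (suc m ⋆ 1# * ⟦ j ⟧)        ≡⟨ -‿distribˡ-* _ _ ⟩
      ⟦ -[1+ m ] ⟧ * ⟦ j ⟧          ∎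

    morphism : ℤ.+-*-rawRing -Raw-AlmostCommutative⟶ fromCommutativeRing commutativeRing
    morphism = record
      { ⟦_⟧    = ⟦_⟧
      ; +-homo = ⟦⟧-+
      ; *-homo = ⟦⟧-*
      ; -‿homo = ⟦⟧-neg
      ; 0-homo = refl
      ; 1-homo = refl
      }

    open import Algebra.Solver.Ring ℤ.+-*-rawRing (fromCommutativeRing commutativeRing) morphism
      (λ i j → Maybe.map (cong ⟦_⟧) (dec⇒weaklyDec ℤ._≟_ i j)) public
      using (solve; con; _:=_; _:+_; _:*_; _:-_; :-_; Polynomial)

    :0 :1 : ∀ {n} → Polynomial n
    :0 = con (posℤ 0)
    :1 = con (posℤ 1)

  open RingSolver using (solve; _:=_; _:+_; _:*_; _:-_; :-_; :0; :1) public

  private variable x y z u v : K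

  ≤⇒0≤- : x ≤ y → 0# ≤ y - x
  ≤⇒0≤- {x} {y} x≤y = subst₂ _≤_ (-‿inverseˡ x) (+-comm (- x) y) (+-monoʳ-≤ (- x) x≤y)

  0≤-⇒≤ : 0# ≤ y - x → x ≤ y
  0≤-⇒≤ {y} {x} h = subst₂ _≤_ (+-identityʳ x)
    (solve 2 (λ x y → x :+ (y :- x) := y) refl x y) (+-monoʳ-≤ x h)

  -- The pattern of most inequalities below: the difference of the two sides is rewritten by the
  -- ring solver as an expression that is visibly nonnegative.
  by-diff : ∀ z → 0# ≤ z → y - x ≡ z → x ≤ y
  by-diff z 0≤z eq = 0≤-⇒≤ (subst (0# ≤_) (sym eq) 0≤z)

  +-nonNeg : 0# ≤ x → 0# ≤ y → 0# ≤ x + y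
  +-nonNeg {x} {y} hx hy = ≤-trans hx (subst (_≤ x + y) (+-identityʳ x) (+-monoʳ-≤ x hy))

  +-mono-≤ : x ≤ y → u ≤ v → x + u ≤ y + v
  +-mono-≤ {x} {y} {u} {v} p q = by-diff _ (+-nonNeg (≤⇒0≤- p) (≤⇒0≤- q))
    (solve 4 (λ x y u v → y :+ v :- (x :+ u) := y :- x :+ (v :- u)) refl x y u v)

  +-nonPosʳ : y ≤ 0# → x + y ≤ x
  +-nonPosʳ {y} {x} h = subst (x + y ≤_) (+-identityʳ x) (+-monoʳ-≤ x h)

  +-nonPosˡ : x ≤ 0# → x + y ≤ y
  +-nonPosˡ {x} {y} h = subst (_≤ y) (+-comm y x) (+-nonPosʳ h)

  +-nonPos : x ≤ 0# → y ≤ 0# → x + y ≤ 0#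
  +-nonPos hx hy = ≤-trans (+-nonPosʳ hy) hx

  ≤0⇒0≤- : x ≤ 0# → 0# ≤ - x
  ≤0⇒0≤- {x} h = subst (0# ≤_) (+-identityˡ (- x)) (≤⇒0≤- h)

  0≤⇒-≤0 : 0# ≤ x → - x ≤ 0#
  0≤⇒-≤0 {x} h = by-diff x h (solve 1 (λ x → :0 :- (:- x) := x) refl x)

  *-monoˡ-≤ : 0# ≤ z → x ≤ y → z * x ≤ z * y
  *-monoˡ-≤ {z} {x} {y} hz h = by-diff _ (*-nonNeg hz (≤⇒0≤- h))
    (solve 3 (λ x y z → z :* y :- z :* x := z :* (y :- x)) refl x y z)

  0≤1 : 0# ≤ 1#
  0≤1 with ≤-total 0# 1#
  ... | inj₁ h = h
  -- If 1 were nonpositive, then 1 = (-1)(-1) would be a product of nonnegative elements.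
  ... | inj₂ h = subst (0# ≤_) (solve 0 (:- :1 :* (:- :1) := :1) refl) (*-nonNeg (≤0⇒0≤- h) (≤0⇒0≤- h))

  ≰⇒≥ : ¬ x ≤ y → y ≤ x
  ≰⇒≥ {x} {y} h with ≤-total x y
  ... | inj₁ p = ⊥-elim (h p)
  ... | inj₂ p = p

  ≰⇒< : ¬ x ≤ y → y < x
  ≰⇒< h = ≰⇒≥ h , λ { refl → h ≤-refl }

  <⇒≱ : x < y → ¬ y ≤ x
  <⇒≱ (p , n) q = n (≤-antisym p q)

  ⁻¹-nonNeg : 0# < x → 0# ≤ x ⁻¹
  ⁻¹-nonNeg {x} (p , n) with ≤-total 0# (x ⁻¹)
  ... | inj₁ h = h
  -- A nonpositive inverse would make -1 = x · (-x⁻¹) nonnegative.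
  ... | inj₂ h = ⊥-elim (0≢1 (≤-antisym 0≤1 (by-diff _ (*-nonNeg p (≤0⇒0≤- h)) eq)))
    where
    eq : 0# - 1# ≡ x * - (x ⁻¹)
    eq = begin
      0# - 1#           ≡⟨ cong (λ w → 0# - w) (⁻¹-inverseʳ x (λ e → n (sym e))) ⟨
      0# - x * x ⁻¹     ≡⟨ solve 2 (λ x y → :0 :- x :* y := x :* (:- y)) refl x (x ⁻¹) ⟩
      x * - (x ⁻¹)      ∎

  cancel-⁻¹ : x ≢ 0# → ∀ y → x ⁻¹ * (x * y) ≡ y
  cancel-⁻¹ {x} n y = begin
    x ⁻¹ * (x * y)  ≡⟨ solve 3 (λ x i y → i :* (x :* y) := x :* i :* y) refl x (x ⁻¹) y ⟩
    x * x ⁻¹ * y    ≡⟨ cong (_* y) (⁻¹-inverseʳ x n) ⟩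
    1# * y          ≡⟨ *-identityˡ y ⟩
    y               ∎

  *-cancelˡ-≤ : 0# < x → x * y ≤ x * z → y ≤ z
  *-cancelˡ-≤ {x} {y} {z} p h =
    subst₂ _≤_ (cancel-⁻¹ (λ e → proj₂ p (sym e)) y) (cancel-⁻¹ (λ e → proj₂ p (sym e)) z)
      (*-monoˡ-≤ (⁻¹-nonNeg p) h)

  sum-nonNeg : ∀ {n} {f : Vector K n} → NonNeg f → 0# ≤ sum f
  sum-nonNeg {zero}  h = ≤-refl
  sum-nonNeg {suc n} h = +-nonNeg (h zero) (sum-nonNeg (h ∘ suc))

  ·-cong : ∀ {n} {x y u v : Vector K n} → (∀ i → x i ≡ y i) → (∀ i → u i ≡ v i) → x · u ≡ y · v
  ·-cong p q = sum-cong-≗ (λ i → cong₂ _*_ (p i) (q i))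

  ·-comm : ∀ {n} (x y : Vector K n) → x · y ≡ y · x
  ·-comm x y = sum-cong-≗ (λ i → *-comm (x i) (y i))

  ·-nonNeg : ∀ {n} {x y : Vector K n} → NonNeg x → NonNeg y → 0# ≤ x · y
  ·-nonNeg p q = sum-nonNeg (λ i → *-nonNeg (p i) (q i))

  ·-distribˡ-+ : ∀ {n} (h x y : Vector K n) → h · (λ i → x i + y i) ≡ h · x + h · y
  ·-distribˡ-+ h x y = trans (sum-cong-≗ (λ i → distribˡ (h i) (x i) (y i))) (∑-distrib-+ (λ i → h i * x i) (λ i → h i * y i))

  ·-scaleʳ : ∀ {n} (h x : Vector K n) t → h · (λ i → t * x i) ≡ t * (h · x)
  ·-scaleʳ h x t = trans (sum-cong-≗ (λ i → solve 3 (λ a b t → a :* (t :* b) := t :* (a :* b)) refl (h i) (x i) t))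
    (sym (*-distribˡ-sum t (λ i → h i * x i)))

  -- Exchanging the two sums shows that a functional on the polytope is determined by its values at
  -- the generators. This is how inequalities in the point become inequalities in the weights.
  ·-combination : ∀ {n k} (h : Vector K n) (w : Vector K k) (g : Fin k → Vector K n) →
    h · (λ j → sum (λ i → w i * g i j)) ≡ w · (λ i → h · g i)
  ·-combination h w g = begin
    sum (λ j → h j * sum (λ i → w i * g i j))    ≡⟨ sum-cong-≗ (λ j → *-distribˡ-sum (h j) (λ i → w i * g i j)) ⟩
    sum (λ j → sum (λ i → h j * (w i * g i j)))  ≡⟨ ∑-comm (λ j i → h j * (w i * g i j)) ⟩
    sum (λ i → sum (λ j → h j * (w i * g i j)))  ≡⟨ sum-cong-≗ (λ i → ·-scaleʳ h (g i) (w i)) ⟩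
    sum (λ i → w i * (h · g i))                  ∎

-- Farkas' lemma and face-preserving rounding

module Rounding {a ℓ} (F : OrderedField a ℓ) where

  open OrderedField F renaming (Carrier to K)
  open Over F
  open FieldProperties F
  open ≡-Reasoning

  Cone : ∀ {d k} → (Fin k → Vector K d) → Vector K d → Set _
  Cone g v = ∃[ μ ] NonNeg μ × (∀ j → v j ≡ sum (λ i → μ i * g i j))

  Separated : ∀ {d k} → (Fin k → Vector K d) → Vector K d → Set _
  Separated g v = ∃[ h ] (∀ i → 0# ≤ h · g i) × ¬ 0# ≤ h · v

  -- The base case of Farkas' lemma: without generators the cone is the origin, and any other `v` is
  -- separated from it by -v, as -v · v is minus a sum of squares.
  zero-or-separated : ∀ {d} (v : Vector K d) → (∀ j → v j ≡ 0#) ⊎ ∃[ h ] ¬ 0# ≤ h · v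
  zero-or-separated v with 0# ≤? (λ j → - v j) · v
  ... | no  h = inj₂ (_ , h)
  ... | yes h = inj₁ (squares v h)
    where
    neg-square : ∀ x → - x * x ≤ 0#
    neg-square x with ≤-total 0# x
    ... | inj₁ p = by-diff _ (*-nonNeg p p) (solve 1 (λ x → :0 :- :- x :* x := x :* x) refl x)
    ... | inj₂ p = by-diff _ (*-nonNeg (≤0⇒0≤- p) (≤0⇒0≤- p))
      (solve 1 (λ x → :0 :- :- x :* x := :- x :* :- x) refl x)
    neg-squares : ∀ {d} (v : Vector K d) → (λ j → - v j) · v ≤ 0#
    neg-squares {zero}  v = ≤-refl
    neg-squares {suc d} v = +-nonPos (neg-square (head v)) (neg-squares (tail v))
    square-zero : ∀ x → 0# ≤ - x * x → x ≡ 0#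
    square-zero x h with x ≟ 0#
    ... | yes e = e
    ... | no  n = trans (sym (cancel-⁻¹ n x)) (trans (cong (x ⁻¹ *_) (begin
      x * x           ≡⟨ solve 1 (λ x → x :* x := :- (:- x :* x)) refl x ⟩
      - (- x * x)     ≡⟨ cong -_ (≤-antisym (neg-square x) h) ⟩
      - 0#            ≡⟨ solve 0 (:- :0 := :0) refl ⟩
      0#              ∎)) (zeroʳ _))
    squares : ∀ {d} (v : Vector K d) → 0# ≤ (λ j → - v j) · v → ∀ j → v j ≡ 0#
    squares {suc d} v h zero = square-zero (head v) (≤-trans h (+-nonPosʳ (neg-squares (tail v))))
    squares {suc d} v h (suc j) = squares (tail v) (≤-trans h (+-nonPosˡ (neg-square (head v)))) j

  -- Projecting along g zero onto the kernel of a functional h that is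
  -- negative on g zero leaves one generator less.
  farkas : ∀ {d} k (g : Fin k → Vector K d) v → Cone g v ⊎ Separated g v
  farkas zero g v with zero-or-separated v
  ... | inj₁ e       = inj₁ ((λ ()) , (λ ()) , e)
  ... | inj₂ (h , n) = inj₂ (h , (λ ()) , n)
  farkas {d} (suc k) g v with farkas k (g ∘ suc) v
  ... | inj₁ (μ , μ≥0 , eq) = inj₁ (0# ◂ μ , (λ { zero → ≤-refl ; (suc i) → μ≥0 i }) ,
    λ j → trans (eq j) (sym (solve 2 (λ z s → :0 :* z :+ s := s) refl (g zero j) (sum (λ i → μ i * g (suc i) j)))))
  ... | inj₂ (h , h≥0 , hv) with 0# ≤? h · g zero
  ...   | yes p = inj₂ (h , (λ { zero → p ; (suc i) → h≥0 i }) , hv)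
  ...   | no  n = project (farkas k (λ i → proj (g (suc i))) (proj v))
    where
    γ = h · g zero
    γ<0 : 0# < - γ
    γ<0 = ≤0⇒0≤- (≰⇒≥ n) , λ e → n (≤-reflexive (begin
      0#       ≡⟨ solve 0 (:0 := :- :0) refl ⟩
      - 0#     ≡⟨ cong -_ e ⟩
      - (- γ)  ≡⟨ solve 1 (λ x → :- :- x := x) refl γ ⟩
      γ        ∎))
    ι = (- γ) ⁻¹
    ιγ : (- γ) * ι ≡ 1#
    ιγ = ⁻¹-inverseʳ (- γ) (λ e → proj₂ γ<0 (sym e))
    proj : Vector K d → Vector K d
    proj u j = u j + ((h · u) * ι) * g zero j
    project : Cone (λ i → proj (g (suc i))) (proj v) ⊎ Separated (λ i → proj (g (suc i))) (proj v) →
              Cone g v ⊎ Separated g v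
    project (inj₁ (μ , μ≥0 , eq)) = inj₁ (τ ◂ μ , (λ { zero → τ≥0 ; (suc i) → μ≥0 i }) , eq′)
      where
      -- Undoing the projections collects their corrections into one coefficient `τ` of `g zero`. It
      -- is nonnegative because `h` is nonnegative on the other generators and negative on `v`.
      σ = sum (λ i → μ i * ((h · g (suc i)) * ι))
      τ = σ + - (h · v) * ι
      ι≥0 = ⁻¹-nonNeg γ<0
      τ≥0 : 0# ≤ τ
      τ≥0 = +-nonNeg (sum-nonNeg (λ i → *-nonNeg (μ≥0 i) (*-nonNeg (h≥0 i) ι≥0)))
                     (*-nonNeg (≤0⇒0≤- (≰⇒≥ hv)) ι≥0)
      eq′ : ∀ j → v j ≡ τ * g zero j + sum (λ i → μ i * g (suc i) j)
      eq′ j = begin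
        v j
          ≡⟨ solve 2 (λ v w → v := v :+ w :- w) refl (v j) w ⟩
        proj v j - w
          ≡⟨ cong (_- w) (eq j) ⟩
        sum (λ i → μ i * (g (suc i) j + ((h · g (suc i)) * ι) * g zero j)) - w
          ≡⟨ cong (_- w) (sum-cong-≗ (λ i →
               solve 4 (λ m x c z → m :* (x :+ c :* z) := m :* x :+ (m :* c) :* z) refl
                 (μ i) (g (suc i) j) ((h · g (suc i)) * ι) (g zero j))) ⟩
        sum (λ i → μ i * g (suc i) j + (μ i * ((h · g (suc i)) * ι)) * g zero j) - w
          ≡⟨ cong (_- w) (∑-distrib-+ (λ i → μ i * g (suc i) j) (λ i → (μ i * ((h · g (suc i)) * ι)) * g zero j)) ⟩
        s + sum (λ i → (μ i * ((h · g (suc i)) * ι)) * g zero j) - w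
          ≡⟨ cong (λ t → s + t - w) (sym (*-distribʳ-sum (g zero j) (λ i → μ i * ((h · g (suc i)) * ι)))) ⟩
        s + σ * g zero j - ((h · v) * ι) * g zero j
          ≡⟨ solve 5 (λ s t g h i → s :+ t :* g :- (h :* i) :* g := (t :+ :- h :* i) :* g :+ s) refl
               s σ (g zero j) (h · v) ι ⟩
        τ * g zero j + s ∎
        where
        w = ((h · v) * ι) * g zero j
        s = sum (λ i → μ i * g (suc i) j)
    project (inj₂ (f , f≥0 , fv)) = inj₂ (e , (λ { zero → ≤-reflexive (sym e₀) ; (suc i) → subst (0# ≤_) (on (g (suc i))) (f≥0 i) }) ,
                                          λ p → fv (subst (0# ≤_) (sym (on v)) p))
      where
      -- This multiple of `h` makes `e` vanish on `g zero`; `e` is then the functional `f` composed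
      -- with the projection.
      c = ι * (f · g zero)
      e : Vector K d
      e j = f j + c * h j
      e· : ∀ u → e · u ≡ f · u + c * (h · u)
      e· u = begin
        e · u                                 ≡⟨ ·-comm e u ⟩
        u · e                                 ≡⟨ ·-distribˡ-+ u f (λ j → c * h j) ⟩
        u · f + u · (λ j → c * h j)           ≡⟨ cong₂ _+_ (·-comm u f) (trans (·-scaleʳ u h c) (cong (c *_) (·-comm u h))) ⟩
        f · u + c * (h · u)                   ∎
      on : ∀ u → f · proj u ≡ e · u
      on u = begin
        f · proj u                                    ≡⟨ ·-distribˡ-+ f u (λ j → ((h · u) * ι) * g zero j) ⟩
        f · u + f · (λ j → ((h · u) * ι) * g zero j)    ≡⟨ cong (f · u +_) (·-scaleʳ f (g zero) ((h · u) * ι)) ⟩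
        f · u + ((h · u) * ι) * (f · g zero)            ≡⟨ solve 4 (λ a h i b → a :+ (h :* i) :* b := a :+ (i :* b) :* h) refl (f · u) (h · u) ι (f · g zero) ⟩
        f · u + c * (h · u)                           ≡⟨ e· u ⟨
        e · u                                         ∎
      e₀ : e · g zero ≡ 0#
      e₀ = begin
        e · g zero                         ≡⟨ e· (g zero) ⟩
        f · g zero + c * γ                 ≡⟨ solve 3 (λ b i γ → b :+ (i :* b) :* γ := b :- (:- γ :* i) :* b) refl (f · g zero) ι γ ⟩
        f · g zero - (- γ * ι) * (f · g zero)  ≡⟨ cong (λ t → f · g zero - t * (f · g zero)) ιγ ⟩
        f · g zero - 1# * (f · g zero)     ≡⟨ solve 1 (λ b → b :- :1 :* b := :0) refl (f · g zero) ⟩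
        0#                                 ∎

  module _ {n} (P : Polytope n) where
    open Polytope P

    -- A functional separating − x̂ from the cone of the generators and − x,
    -- everything homogenised, would cut out a face containing x but not x̂.
    minimalFace-conic : ∀ {x x̂} → InMinimalFace P x x̂ →
      ∃[ μ ] NonNeg μ × (∀ j → x̂ j + sum (λ i → μ i * generator i j) ≡ (1# + sum μ) * x j)
    minimalFace-conic {x} {x̂} (G , (((w , w≥0 , w≡1 , x≡) , xG) , minimal) , x̂∈G@(x̂∈P , _))
      -- The extra coordinate 1 turns affine inequalities into linear ones, so that a separating
      -- functional is a normal vector together with an offset.
      with farkas (suc size) ((λ j → - hom x j) ◂ (λ i → hom (generator i))) (λ j → - hom x̂ j)
      where
      hom : Vector K n → Vector K (suc n)
      hom y = 1# ◂ y
    ... | inj₁ (μ , μ≥0 , eq) = tail μ , μ≥0 ∘ suc , λ j → begin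
        x̂ j + sum (λ i → tail μ i * generator i j)
          ≡⟨ solve 4 (λ y s t x → y :+ s := y :+ (t :* (:- x) :+ s) :+ t :* x) refl (x̂ j) _ (head μ) (x j) ⟩
        x̂ j + (head μ * - x j + sum (λ i → tail μ i * generator i j)) + head μ * x j
          ≡⟨ cong (λ t → x̂ j + t + head μ * x j) (sym (eq (suc j))) ⟩
        x̂ j + - x̂ j + head μ * x j
          ≡⟨ solve 3 (λ y t x → y :+ :- y :+ t :* x := t :* x) refl (x̂ j) (head μ) (x j) ⟩
        head μ * x j
          ≡⟨ cong (_* x j) τ≡ ⟩
        (1# + sum (tail μ)) * x j ∎
      where
      -- The homogenising coordinate compares total weights and so determines the coefficient of
      -- `x`.
      τ≡ : head μ ≡ 1# + sum (tail μ)
      τ≡ = begin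
        head μ
          ≡⟨ solve 2 (λ t s → t := :1 :+ (:- :1 :- (t :* (:- :1) :+ s)) :+ s) refl (head μ) (sum (tail μ)) ⟩
        1# + (- 1# - (head μ * - 1# + sum (tail μ))) + sum (tail μ)
          ≡⟨ cong (λ t → 1# + (- 1# - (head μ * - 1# + t)) + sum (tail μ))
               (sum-cong-≗ (λ i → sym (solve 1 (λ t → t :* :1 := t) refl (tail μ i)))) ⟩
        1# + (- 1# - (head μ * - 1# + sum (λ i → tail μ i * 1#))) + sum (tail μ)
          ≡⟨ cong (λ t → 1# + (- 1# - t) + sum (tail μ)) (sym (eq zero)) ⟩
        1# + (- 1# - - 1#) + sum (tail μ)
          ≡⟨ solve 1 (λ s → :1 :+ (:- :1 :- :- :1) :+ s := :1 :+ s) refl (sum (tail μ)) ⟩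
        1# + sum (tail μ) ∎
    ... | inj₂ (h , h≥0 , hx̂) = ⊥-elim (hx̂ (≤-reflexive (sym (begin
        h · (λ j → - hom x̂ j)                       ≡⟨ ·-neg h (hom x̂) ⟩
        - (h₀ * 1# + h′ · x̂)                        ≡⟨ cong (λ t → - (h₀ * 1# + t)) (trans (solve 1 (λ t → t := :- :- t) refl (h′ · x̂)) (cong -_ (trans (sym (·-negˡ h′ x̂)) (proj₂ (minimal H (x∈P , xH) x̂ x̂∈G))))) ⟩
        - (h₀ * 1# + - h₀)                          ≡⟨ solve 1 (λ t → :- (t :* :1 :+ :- t) := :0) refl h₀ ⟩
        0#                                          ∎))))
      where
      hom : Vector K n → Vector K (suc n)
      hom y = 1# ◂ y
      h₀ = head h
      h′ = tail h
      x∈P : x ∈ P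
      x∈P = w , w≥0 , w≡1 , x≡
      ·-neg : ∀ {d} (u v : Vector K d) → u · (λ j → - v j) ≡ - (u · v)
      ·-neg u v = begin
        u · (λ j → - v j)         ≡⟨ ·-cong {x = u} (λ _ → refl) (λ j → solve 1 (λ t → :- t := :- :1 :* t) refl (v j)) ⟩
        u · (λ j → - 1# * v j)    ≡⟨ ·-scaleʳ u v (- 1#) ⟩
        - 1# * (u · v)            ≡⟨ solve 1 (λ t → :- :1 :* t := :- t) refl (u · v) ⟩
        - (u · v)                 ∎
      ·-negˡ : ∀ {d} (u v : Vector K d) → (λ j → - u j) · v ≡ - (u · v)
      ·-negˡ u v = trans (·-comm (λ j → - u j) v) (trans (·-neg v u) (cong -_ (·-comm v u)))
      H : Face P
      H = record
        { normal = λ j → - h′ j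
        ; offset = h₀
        ; valid  = λ { y (v , v≥0 , v≡1 , y≡) → by-diff _ (sum-nonNeg (λ i → *-nonNeg (v≥0 i) (h≥0 (suc i)))) (begin
            h₀ - (λ j → - h′ j) · y           ≡⟨ cong (λ t → h₀ - t) (·-negˡ h′ y) ⟩
            h₀ - - (h′ · y)                   ≡⟨ solve 2 (λ t s → t :- :- s := :1 :* (t :* :1) :+ s) refl h₀ (h′ · y) ⟩
            1# * (h₀ * 1#) + h′ · y           ≡⟨ cong₂ (λ s t → s * (h₀ * 1#) + t) (sym v≡1) (trans (·-cong {x = h′} (λ _ → refl) y≡) (·-combination h′ v generator)) ⟩
            sum v * (h₀ * 1#) + v · (λ i → h′ · generator i) ≡⟨ cong (_+ v · (λ i → h′ · generator i)) (*-distribʳ-sum (h₀ * 1#) v) ⟩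
            sum (λ i → v i * (h₀ * 1#)) + v · (λ i → h′ · generator i) ≡⟨ ·-distribˡ-+ v (λ _ → h₀ * 1#) (λ i → h′ · generator i) ⟨
            v · (λ i → h · hom (generator i)) ∎) }
        }
      -- Nonnegativity of `h` on the generator -hom x is the reverse of the valid inequality at `x`,
      -- which forces equality there.
      xH : (λ j → - h′ j) · x ≡ h₀
      xH = ≤-antisym (Face.valid H x x∈P) (by-diff _ (h≥0 zero) (begin
        (λ j → - h′ j) · x - h₀     ≡⟨ cong (_- h₀) (·-negˡ h′ x) ⟩
        - (h′ · x) - h₀             ≡⟨ solve 2 (λ t s → :- s :- t := :- (t :* :1 :+ s)) refl h₀ (h′ · x) ⟩
        - (h · hom x)               ≡⟨ ·-neg h (hom x) ⟨
        h · (λ j → - hom x j)       ∎))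

    -- Here (M x + (x − x̂) + y) / (M + 1) lies in P and satisfies the budgets
    -- scaled by α for large M, and the optimality of x compares y with x̂.
    rounding-cost : (∀ x → x ∈ P → NonNeg x) → ∀ {α β} → 1# ≤ α → (I : Instance n) →
      let open Instance I in ∀ {x x̂} →
      Feasible P unweighted α x → (∀ y → Feasible P unweighted α y → cost · x ≤ cost · y) →
      IsRounding P α β unweighted x x̂ → ∀ y → Feasible P unweighted 1# y → cost · x̂ ≤ cost · y
    rounding-cost P≥0 {α} {β} 1≤α I {x} {x̂} feas@((w , w≥0 , w≡1 , x≡) , Ax≤) opt R y ((v , v≥0 , v≡1 , y≡) , Ay≤) =
      -- Evaluated at `z`, the multiples of `cost · x` cancel: c y - c x̂ equals (M + 1)(c z - c x),
      -- and optimality of `x` makes this nonnegative.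
      by-diff _ (*-nonNeg M+1≥0 (≤⇒0≤- (opt z (z∈P , Az≤)))) (begin
        cost · y - cost · x̂
          ≡⟨ solve 4 (λ M x x̂ y → y :- x̂ := M :* x :+ (x :- x̂) :+ y :- (M :+ :1) :* x) refl M (cost · x) (cost · x̂) (cost · y) ⟩
        M * (cost · x) + (cost · x - cost · x̂) + cost · y - (M + 1#) * (cost · x)
          ≡⟨ cong (_- (M + 1#) * (cost · x)) (sym (at-z cost)) ⟩
        (M + 1#) * (cost · z) - (M + 1#) * (cost · x)
          ≡⟨ solve 3 (λ M z x → M :* z :- M :* x := M :* (z :- x)) refl (M + 1#) (cost · z) (cost · x) ⟩
        (M + 1#) * (cost · z - cost · x) ∎)
      where
      open Instance I
      open IsRounding R
      conic = minimalFace-conic P1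
      μ = proj₁ conic
      μ≥0 = proj₁ (proj₂ conic)
      x̂+ = proj₂ (proj₂ conic)
      α>0 : 0# < α
      α>0 = ≤-trans 0≤1 1≤α , λ { refl → 0≢1 (≤-antisym 0≤1 1≤α) }
      x̂∈P = proj₁ (IsRounding.extreme R)

      -- One multiplier serves all indices at once: the sum of the ratios `t i * s i ⁻¹` over the
      -- nonzero `s i`. Each summand is nonnegative, so enlarging the multiplier preserves the
      -- inequalities already obtained.
      slack : ∀ {k} (s t : Vector K k) → (∀ i → 0# ≤ s i) → (∀ i → 0# ≤ t i) →
        ∃[ M ] 0# ≤ M × (∀ i → s i ≡ 0# ⊎ t i ≤ M * s i)
      slack {zero}  s t s≥0 t≥0 = 0# , ≤-refl , λ ()
      slack {suc k} s t s≥0 t≥0 with slack (tail s) (tail t) (s≥0 ∘ suc) (t≥0 ∘ suc) | head s ≟ 0#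
      ... | M , M≥0 , f | yes e = M , M≥0 , λ { zero → inj₁ e ; (suc i) → f i }
      ... | M , M≥0 , f | no  e = M + δ , +-nonNeg M≥0 δ≥0 , λ
        { zero    → inj₂ (by-diff _ (*-nonNeg M≥0 (s≥0 zero)) (begin
            (M + δ) * head s - head t                ≡⟨ solve 4 (λ M t i s → (M :+ t :* i) :* s :- t := M :* s :+ (t :* (s :* i) :- t)) refl M (head t) (head s ⁻¹) (head s) ⟩
            M * head s + (head t * (head s * head s ⁻¹) - head t)  ≡⟨ cong (λ u → M * head s + (head t * u - head t)) (⁻¹-inverseʳ _ e) ⟩
            M * head s + (head t * 1# - head t)      ≡⟨ solve 3 (λ M s t → M :* s :+ (t :* :1 :- t) := M :* s) refl M (head s) (head t) ⟩
            M * head s                               ∎))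
        ; (suc i) → map₂ (λ p → ≤-trans p (by-diff _ (*-nonNeg δ≥0 (s≥0 (suc i)))
                      (solve 3 (λ M m s → (M :+ m) :* s :- M :* s := m :* s) refl M δ (s (suc i))))) (f i)
        }
        where
        δ = head t * head s ⁻¹
        δ≥0 = *-nonNeg (t≥0 zero) (⁻¹-nonNeg (s≥0 zero , λ p → e (sym p)))

      slacks = slack (λ i → α * b i - A i · x) b (λ i → ≤⇒0≤- (Ax≤ i)) b-nonNeg
      M₀ = proj₁ slacks
      M₀≥0 = proj₁ (proj₂ slacks)
      σ = sum μ
      -- `M₀` lets the slack of the loose budgets pay for `y`, and `σ` keeps the point in the
      -- polytope: M x + (x - x̂) = M₀ x + ((1 + σ) x - x̂), where the bracket is the nonnegative
      -- combination of generators with weights `μ`. Adding `y` gives total weight M + 1.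
      M = M₀ + σ
      σ≥0 = sum-nonNeg μ≥0
      M≥0 = +-nonNeg M₀≥0 σ≥0
      M+1≥0 = +-nonNeg M≥0 0≤1
      M+1>0 : 0# < M + 1#
      M+1>0 = M+1≥0 , λ e → 0≢1 (≤-antisym 0≤1 (by-diff M M≥0 (begin
        0# - 1#      ≡⟨ cong (_- 1#) e ⟩
        M + 1# - 1#  ≡⟨ solve 1 (λ m → m :+ :1 :- :1 := m) refl M ⟩
        M            ∎)))
      ι = (M + 1#) ⁻¹
      M+1≢0 : M + 1# ≢ 0#
      M+1≢0 e = proj₂ M+1>0 (sym e)

      ω : Vector K size
      ω i = ι * (μ i + M₀ * w i + v i)
      z : Vector K n
      z j = sum (λ i → ω i * generator i j)
      cancel : ∀ t → (M + 1#) * (ι * t) ≡ t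
      cancel t = trans (solve 3 (λ M i t → M :* (i :* t) := i :* (M :* t)) refl (M + 1#) ι t) (cancel-⁻¹ M+1≢0 t)
      linear : (f : Vector K size) → ω · f ≡ ι * (μ · f + M₀ * (w · f) + v · f)
      linear f = begin
        ω · f                                             ≡⟨ ·-comm ω f ⟩
        f · ω                                             ≡⟨ ·-scaleʳ f (λ i → μ i + M₀ * w i + v i) ι ⟩
        ι * (f · (λ i → μ i + M₀ * w i + v i))            ≡⟨ cong (ι *_) (·-distribˡ-+ f (λ i → μ i + M₀ * w i) v) ⟩
        ι * (f · (λ i → μ i + M₀ * w i) + f · v)          ≡⟨ cong (λ t → ι * (t + f · v)) (·-distribˡ-+ f μ (λ i → M₀ * w i)) ⟩
        ι * (f · μ + f · (λ i → M₀ * w i) + f · v)        ≡⟨ cong (λ t → ι * (f · μ + t + f · v)) (·-scaleʳ f w M₀) ⟩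
        ι * (f · μ + M₀ * (f · w) + f · v)                ≡⟨ cong (ι *_) (cong₂ _+_ (cong₂ (λ s t → s + M₀ * t) (·-comm f μ) (·-comm f w)) (·-comm f v)) ⟩
        ι * (μ · f + M₀ * (w · f) + v · f)                ∎
      ·1 : (u : Vector K size) → u · (λ _ → 1#) ≡ sum u
      ·1 u = sum-cong-≗ (λ i → *-identityʳ (u i))
      z∈P : z ∈ P
      z∈P = ω , (λ i → *-nonNeg (⁻¹-nonNeg M+1>0) (+-nonNeg (+-nonNeg (μ≥0 i) (*-nonNeg M₀≥0 (w≥0 i))) (v≥0 i))) , (begin
        sum ω                                            ≡⟨ ·1 ω ⟨
        ω · (λ _ → 1#)                                   ≡⟨ linear (λ _ → 1#) ⟩
        ι * (μ · (λ _ → 1#) + M₀ * (w · (λ _ → 1#)) + v · (λ _ → 1#))  ≡⟨ cong (ι *_) (cong₂ _+_ (cong₂ (λ s t → s + M₀ * t) (·1 μ) (trans (·1 w) w≡1)) (trans (·1 v) v≡1)) ⟩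
        ι * (σ + M₀ * 1# + 1#)                           ≡⟨ solve 3 (λ i s M → i :* (s :+ M :* :1 :+ :1) := (M :+ s :+ :1) :* i) refl ι σ M₀ ⟩
        (M + 1#) * ι                                     ≡⟨ ⁻¹-inverseʳ (M + 1#) M+1≢0 ⟩
        1#                                               ∎) , λ j → refl

      at : (f : Vector K n) {u : Vector K size} {p : Vector K n} →
        (∀ j → p j ≡ sum (λ i → u i * generator i j)) → f · p ≡ u · (λ i → f · generator i)
      at f {u} p≡ = trans (·-cong {x = f} (λ _ → refl) p≡) (·-combination f u generator)
      at-μ : (f : Vector K n) → μ · (λ i → f · generator i) ≡ (1# + σ) * (f · x) - f · x̂
      at-μ f = begin
        μ · (λ i → f · generator i)                       ≡⟨ ·-combination f μ generator ⟨
        f · g                                             ≡⟨ solve 2 (λ a b → a := b :+ a :- b) refl (f · g) (f · x̂) ⟩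
        f · x̂ + f · g - f · x̂                             ≡⟨ cong (_- f · x̂) (·-distribˡ-+ f x̂ g) ⟨
        f · (λ j → x̂ j + g j) - f · x̂                     ≡⟨ cong (_- f · x̂) (·-cong {x = f} (λ _ → refl) x̂+) ⟩
        f · (λ j → (1# + σ) * x j) - f · x̂                ≡⟨ cong (_- f · x̂) (·-scaleʳ f x (1# + σ)) ⟩
        (1# + σ) * (f · x) - f · x̂                        ∎
        where g = λ j → sum (λ i → μ i * generator i j)
      at-z : (f : Vector K n) → (M + 1#) * (f · z) ≡ M * (f · x) + (f · x - f · x̂) + f · y
      at-z f = begin
        (M + 1#) * (f · z)                                ≡⟨ cong ((M + 1#) *_) (trans (·-combination f ω generator) (linear _)) ⟩
        (M + 1#) * (ι * (μ · fg + M₀ * (w · fg) + v · fg)) ≡⟨ cancel _ ⟩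
        μ · fg + M₀ * (w · fg) + v · fg                   ≡⟨ cong₂ _+_ (cong₂ (λ s t → s + M₀ * t) (at-μ f) (sym (at f x≡))) (sym (at f y≡)) ⟩
        (1# + σ) * (f · x) - f · x̂ + M₀ * (f · x) + f · y ≡⟨ solve 5 (λ s x x̂ M y → (:1 :+ s) :* x :- x̂ :+ M :* x :+ y := (M :+ s) :* x :+ (x :- x̂) :+ y) refl σ (f · x) (f · x̂) M₀ (f · y) ⟩
        M * (f · x) + (f · x - f · x̂) + f · y             ∎
        where fg = λ i → f · generator i

      Ay≤b : ∀ i → A i · y ≤ b i
      Ay≤b i = subst (A i · y ≤_) (*-identityˡ (b i)) (Ay≤ i)

      budget : ∀ i → M * (A i · x) + (A i · x - A i · x̂) + A i · y ≤ (M + 1#) * (α * b i)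
      budget i with proj₂ (proj₂ slacks) i
      -- On a tight budget P3 says b ≤ A x̂ once α is cancelled. Since also A y ≤ b, replacing x̂ by
      -- y does not raise the load.
      ... | inj₁ s≡0 = by-diff _ (≤⇒0≤- (≤-trans (Ay≤b i) b≤)) (begin
          (M + 1#) * (α * b i) - (M * (A i · x) + (A i · x - A i · x̂) + A i · y)
            ≡⟨ cong (λ t → (M + 1#) * (α * b i) - (M * t + (t - A i · x̂) + A i · y)) tight ⟩
          (M + 1#) * (α * b i) - (M * (α * b i) + (α * b i - A i · x̂) + A i · y)
            ≡⟨ solve 4 (λ M c x̂ y → (M :+ :1) :* c :- (M :* c :+ (c :- x̂) :+ y) := x̂ :- y) refl M (α * b i) (A i · x̂) (A i · y) ⟩
          A i · x̂ - A i · y ∎)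
        where
        tight : A i · x ≡ α * b i
        tight = begin
          A i · x                          ≡⟨ solve 2 (λ a c → a := c :- (c :- a)) refl (A i · x) (α * b i) ⟩
          α * b i - (α * b i - A i · x)    ≡⟨ cong (λ t → α * b i - t) s≡0 ⟩
          α * b i - 0#                     ≡⟨ solve 1 (λ c → c :- :0 := c) refl (α * b i) ⟩
          α * b i                          ∎
        b≤ : b i ≤ A i · x̂
        b≤ = subst (_≤ A i · x̂) (begin
          (A i · x) * α ⁻¹        ≡⟨ cong (_* α ⁻¹) tight ⟩
          (α * b i) * α ⁻¹        ≡⟨ *-comm _ _ ⟩
          α ⁻¹ * (α * b i)        ≡⟨ cancel-⁻¹ (λ e → proj₂ α>0 (sym e)) (b i) ⟩
          b i                     ∎) (P3 feas i tight)
      -- On a loose budget nothing is known of A x̂ beyond its sign, which comes from the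
      -- nonnegativity of A and of the polytope; the slack multiplied by `M₀` covers b and hence A
      -- y.
      ... | inj₂ b≤Ms = by-diff _
          (+-nonNeg (+-nonNeg (≤⇒0≤- b≤Ms) (≤⇒0≤- (Ay≤b i)))
            (+-nonNeg (*-nonNeg σ≥0 s≥0) (+-nonNeg s≥0 (·-nonNeg (A-nonNeg i) (P≥0 x̂ x̂∈P)))))
          (solve 7 (λ M s c x x̂ y b → (M :+ s :+ :1) :* c :- ((M :+ s) :* x :+ (x :- x̂) :+ y) :=
                      M :* (c :- x) :- b :+ (b :- y) :+ (s :* (c :- x) :+ (c :- x :+ x̂))) refl
             M₀ σ (α * b i) (A i · x) (A i · x̂) (A i · y) (b i))
        where s≥0 = ≤⇒0≤- (Ax≤ i)

      Az≤ : ∀ i → A i · z ≤ α * b i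
      Az≤ i = *-cancelˡ-≤ M+1>0 (subst (_≤ (M + 1#) * (α * b i)) (sym (at-z (A i))) (budget i))

-- Fourier–Motzkin elimination

infixl 5 _▹_
-- Elimination consumes rows from the front, so the objective variable and the constant term are
-- attached at the end.
_▹_ : ∀ {a} {A : Set a} {n} → Vector A n → A → Vector A (suc n)
_▹_ {n = zero}  xs x = λ _ → x
_▹_ {n = suc n} xs x = head xs ◂ (tail xs ▹ x)

front : ∀ {a} {A : Set a} {n} → Vector A (suc n) → Vector A n
front {n = suc n} xs = head xs ◂ front (tail xs)

end : ∀ {a} {A : Set a} {n} → Vector A (suc n) → A
end {n = zero}  xs = head xs
end {n = suc n} xs = end (tail xs)

front-▹ : ∀ {a} {A : Set a} {n} (xs : Vector A n) x i → front (xs ▹ x) i ≡ xs i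
front-▹ xs x zero    = refl
front-▹ xs x (suc i) = front-▹ (tail xs) x i

end-▹ : ∀ {a} {A : Set a} {n} (xs : Vector A n) x → end (xs ▹ x) ≡ x
end-▹ {n = zero}  xs x = refl
end-▹ {n = suc n} xs x = end-▹ (tail xs) x

tabulate-▹ : ∀ {a} {A : Set a} {n} (xs : Vector A n) x →
  List.tabulate (xs ▹ x) ≡ List.tabulate xs List.++ List.[ x ]
tabulate-▹ {n = zero}  xs x = refl
tabulate-▹ {n = suc n} xs x = cong (head xs ∷_) (tabulate-▹ (tail xs) x)

▹-all : ∀ {a p} {A : Set a} (P : A → Set p) {n} {xs : Vector A n} {x} → (∀ i → P (xs i)) → P x → ∀ i → P ((xs ▹ x) i)
▹-all P {zero}  h q i       = q
▹-all P {suc n} h q zero    = h zero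
▹-all P {suc n} h q (suc i) = ▹-all P (h ∘ suc) q i

▹-zip : ∀ {a b r} {A : Set a} {B : Set b} (R : A → B → Set r) {n} {xs : Vector A n} {ys : Vector B n} {x y} →
  (∀ i → R (xs i) (ys i)) → R x y → ∀ i → R ((xs ▹ x) i) ((ys ▹ y) i)
▹-zip R {zero}  h q i       = q
▹-zip R {suc n} h q zero    = h zero
▹-zip R {suc n} h q (suc i) = ▹-zip R (h ∘ suc) q i

module FourierMotzkin {a ℓ} (F : OrderedField a ℓ) where

  open OrderedField F renaming (Carrier to K)
  open Over F using (_·_)
  open FieldProperties F
  open ≡-Reasoning

  -- A row p stands for the constraint affine p x ≤ 0#, its last entry being
  -- the constant term.
  Row : ℕ → Set a
  Row k = Vector K (suc k)

  affine : ∀ {k} → Row k → Vector K k → K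
  affine {zero}  p x = head p
  affine {suc k} p x = head p * head x + affine (tail p) (tail x)

  affine-▹ : ∀ {k} (f : Vector K k) c x → affine (f ▹ c) x ≡ f · x + c
  affine-▹ {zero}  f c x = sym (+-identityˡ c)
  affine-▹ {suc k} f c x = trans (cong (head f * head x +_) (affine-▹ (tail f) c (tail x))) (sym (+-assoc _ _ _))

  ▹-· : ∀ {k} (f : Vector K k) c x → (f ▹ c) · x ≡ f · front x + c * end x
  ▹-· {zero}  f c x = +-comm (c * head x) 0#
  ▹-· {suc k} f c x = trans (cong (head f * head x +_) (▹-· (tail f) c (tail x))) (sym (+-assoc _ _ _))

  Sat : ∀ {k} → List (Row k) → Vector K k → Set _
  Sat rows x = ∀ {p} → p ∈ₗ rows → affine p x ≤ 0#

  NonPos : ∀ {k} → Vector K k → Set _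
  NonPos x = ∀ i → x i ≤ 0#

  positive nonPositive : ∀ {k} → List (Row k) → List (Row k)
  positive    = filter (λ p → ¬? (head p ≤? 0#))
  nonPositive = filter (λ p → head p ≤? 0#)

  -- With head p > 0 and head q ≤ 0 this adds nonnegative multiples of both constraints, chosen
  -- without division so that the leading coefficients cancel; the cancelled entry is dropped.
  combine : ∀ {k} → Row (suc k) → Row (suc k) → Row k
  combine p q i = head p * q (suc i) - head q * p (suc i)

  -- All variables are constrained to be nonpositive. Combined with this
  -- constraint, the rows that do not involve the first variable survive its
  -- elimination.
  bound : ∀ {k} → Row (suc k)
  bound = 1# ◂ λ _ → 0#

  -- The reversals match the order in which the machine below produces the rows.
  eliminate : ∀ {k} → List (Row (suc k)) → List (Row k)
  eliminate rows = cartesianProductWith combine (reverse (positive rows)) (reverse (nonPositive rows))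

  final : ∀ k → List (Row k) → List (Row zero)
  final zero    rows = rows
  final (suc k) rows = final k (eliminate (bound ∷ rows))

  affine-0 : ∀ {k} (x : Vector K k) → affine (λ _ → 0#) x ≡ 0#
  affine-0 {zero}  x = refl
  affine-0 {suc k} x = trans (cong₂ _+_ (zeroˡ (head x)) (affine-0 (tail x))) (+-identityˡ 0#)

  affine-bound : ∀ {k} (x : Vector K (suc k)) → affine bound x ≡ head x
  affine-bound x = trans (cong₂ _+_ (*-identityˡ (head x)) (affine-0 (tail x))) (+-identityʳ (head x))

  affine-combine : ∀ {k} (p q : Row (suc k)) x →
    affine (combine p q) x ≡ head p * affine (tail q) x - head q * affine (tail p) x
  affine-combine {zero}  p q x = refl
  -- The recursion removes the second entries: the leading ones are the multipliers and have to
  -- stay.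
  affine-combine {suc k} p q x = trans (cong (combine p q zero * head x +_) (affine-combine (head p ◂ tail (tail p)) (head q ◂ tail (tail q)) (tail x)))
    (solve 7 (λ p q p′ q′ x u v → (p :* q′ :- q :* p′) :* x :+ (p :* v :- q :* u) :=
                                  p :* (q′ :* x :+ v) :- q :* (p′ :* x :+ u)) refl
      (head p) (head q) (p (suc zero)) (q (suc zero)) (head x) (affine (tail (tail p)) (tail x)) (affine (tail (tail q)) (tail x)))

  eliminate-sound : ∀ {k} (rows : List (Row (suc k))) x → Sat rows x → Sat (eliminate rows) (tail x)
  eliminate-sound rows x sat r∈ with ∈-cartesianProductWith⁻ combine (reverse (positive rows)) _ r∈
  ... | p , q , p∈ , q∈ , refl with ∈-filter⁻ _ (reverse⁻ p∈) | ∈-filter⁻ _ (reverse⁻ q∈)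
  ...   | p∈ , p>0 | q∈ , q≤0 = by-diff _ (+-nonNeg (*-nonNeg (proj₁ (≰⇒< p>0)) (≤0⇒0≤- (sat q∈))) (*-nonNeg (≤0⇒0≤- q≤0) (≤0⇒0≤- (sat p∈))))
    (trans (cong (λ t → 0# - t) (affine-combine p q (tail x)))
      (solve 5 (λ p q x u v → :0 :- (p :* v :- q :* u) := p :* :- (q :* x :+ v) :+ :- q :* :- (p :* x :+ u)) refl
        (head p) (head q) (head x) (affine (tail p) (tail x)) (affine (tail q) (tail x))))

  bound-satisfied : ∀ {k} {rows : List (Row (suc k))} {y} → NonPos y → Sat rows y → Sat (bound ∷ rows) y
  bound-satisfied {y = y} np sat (here refl) = subst (_≤ 0#) (sym (affine-bound y)) (np zero)
  bound-satisfied         np sat (there p∈)  = sat p∈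

  -- A row without variables is a bare constant, and a positive one is a contradiction derived from
  -- the original rows. A leftover positive row therefore certifies infeasibility.
  final-sound : ∀ k (rows : List (Row k)) x → NonPos x → Sat rows x → positive (final k rows) ≡ []
  final-sound zero    rows x _  sat = filter-none _ {xs = rows} (All.tabulate (λ p∈ p≰0 → p≰0 (sat p∈)))
  final-sound (suc k) rows x np sat = final-sound k _ (tail x) (np ∘ suc) (eliminate-sound (bound ∷ rows) x (bound-satisfied np sat))

  -- Each row with positive leading coefficient is an upper bound on the first variable in terms of
  -- the others. `t` is the least of these bounds, and `pivot` is a row attaining it.
  record IsLeastBound {k} (rows : List (Row (suc k))) (x : Vector K k) (t : K) : Set (a ⊔ ℓ) where
    field
      below   : Sat (positive rows) (t ◂ x)
      pivot   : Row (suc k)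
      pivot∈  : pivot ∈ₗ positive rows
      tight   : affine pivot (t ◂ x) ≡ 0#

  module _ {k} {rows : List (Row (suc k))} {x : Vector K k} {t} (B : IsLeastBound rows x t) where
    open IsLeastBound B

    pivot>0 : 0# < head pivot
    pivot>0 = ≰⇒< (proj₂ (∈-filter⁻ _ {xs = rows} pivot∈))

    -- As `pivot` is tight at `t`, its combination with a nonpositive row `q` evaluates to
    -- `head pivot` times the value of `q` at `t ◂ x`, so the eliminated system already contains the
    -- remaining constraints.
    eliminate-complete : Sat (eliminate rows) x → Sat rows (t ◂ x)
    eliminate-complete sat {q} q∈ with head q ≤? 0#
    ... | no  q≰0 = below (∈-filter⁺ _ q∈ q≰0)
    ... | yes q≤0 = *-cancelˡ-≤ pivot>0 (subst₂ _≤_ eq (sym (zeroʳ _))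
        (sat (∈-cartesianProductWith⁺ combine (reverse⁺ pivot∈) (reverse⁺ (∈-filter⁺ _ q∈ q≤0)))))
      where
      eq : affine (combine pivot q) x ≡ head pivot * affine q (t ◂ x)
      eq = begin
        affine (combine pivot q) x
          ≡⟨ affine-combine pivot q x ⟩
        head pivot * affine (tail q) x - head q * affine (tail pivot) x
          ≡⟨ solve 5 (λ p q t u v → p :* v :- q :* u := p :* (q :* t :+ v) :- q :* (p :* t :+ u)) refl
               (head pivot) (head q) t (affine (tail pivot) x) (affine (tail q) x) ⟩
        head pivot * affine q (t ◂ x) - head q * affine pivot (t ◂ x)
          ≡⟨ cong (λ s → head pivot * affine q (t ◂ x) - head q * s) tight ⟩
        head pivot * affine q (t ◂ x) - head q * 0#
          ≡⟨ solve 2 (λ s q → s :- q :* :0 := s) refl (head pivot * affine q (t ◂ x)) (head q) ⟩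
        head pivot * affine q (t ◂ x) ∎

    -- Any larger value would violate the row that is tight at `t`.
    leastBound-greatest : ∀ s → Sat rows (s ◂ x) → s ≤ t
    leastBound-greatest s sat = *-cancelˡ-≤ pivot>0 (by-diff _ (≤0⇒0≤- (sat (proj₁ (∈-filter⁻ _ {xs = rows} pivot∈)))) (begin
      head pivot * t - head pivot * s
        ≡⟨ solve 4 (λ p t s u → p :* t :- p :* s := (p :* t :+ u) :- (p :* s :+ u)) refl (head pivot) t s (affine (tail pivot) x) ⟩
      affine pivot (t ◂ x) - affine pivot (s ◂ x)
        ≡⟨ cong (_- affine pivot (s ◂ x)) tight ⟩
      0# - affine pivot (s ◂ x)
        ≡⟨ +-identityˡ _ ⟩
      - affine pivot (s ◂ x) ∎))

  record IsBest {k} (rows : List (Row (suc k))) (x : Vector K (suc k)) : Set (a ⊔ ℓ) where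
    field
      nonPos  : NonPos x
      sat     : Sat rows x
      maximal : ∀ y → NonPos y → Sat rows y → end y ≤ end x

  Best : ∀ k → List (Row k) → Vector K k → Set (a ⊔ ℓ)
  Best zero    rows x = Sat rows x
  Best (suc k) rows x = IsBest rows x

  best-sat : ∀ k {rows} {x} → Best k rows x → Sat rows x
  best-sat zero    sat = sat
  best-sat (suc k) b   = IsBest.sat b

  best-nonPos : ∀ k {rows} {x} → Best k rows x → NonPos x
  best-nonPos (suc k) b = IsBest.nonPos b

  best-zero : ∀ rows x → positive rows ≡ [] → Best zero rows x
  best-zero rows x none {p} p∈ with head p ≤? 0#
  ... | yes p≤0 = p≤0
  ... | no  p≰0 with subst (p ∈ₗ_) none (∈-filter⁺ _ p∈ p≰0)
  ...   | ()

  -- If one variable is left, it is the objective and its least upper bound is its maximum. Further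
  -- variables are only prepended to that solution, and the tail of any competitor solves the
  -- eliminated system, so the last coordinate remains maximal.
  best-suc : ∀ k (rows : List (Row (suc k))) {x t} →
    Best k (eliminate (bound ∷ rows)) x → IsLeastBound (bound ∷ rows) x t → Best (suc k) rows (t ◂ x)
  best-suc k rows {x} {t} best lb = record
    { nonPos  = λ { zero → subst (_≤ 0#) (affine-bound (t ◂ x)) (sat (here refl)) ; (suc i) → best-nonPos k best i }
    ; sat     = sat ∘ there
    ; maximal = maximal k best lb
    }
    where
    sat : Sat (bound ∷ rows) (t ◂ x)
    sat = eliminate-complete lb (best-sat k best)
    maximal : ∀ k {rows : List (Row (suc k))} {x} → Best k (eliminate (bound ∷ rows)) x → IsLeastBound (bound ∷ rows) x t →
      ∀ y → NonPos y → Sat rows y → end y ≤ end (t ◂ x)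
    maximal zero    {rows} {x} _ lb y np sat =
      leastBound-greatest lb (y zero) (bound-satisfied {rows = rows} {y = y zero ◂ x} (λ { zero → np zero }) sat)
    maximal (suc k) {rows} b lb y np sat =
      IsBest.maximal b (tail y) (np ∘ suc) (eliminate-sound (bound ∷ rows) y (bound-satisfied np sat))

-- Programs and their weakest preconditions

-- Scalars are the tops of their stacks; superseded values stay below them.
-- The registers pos k and neg k hold the rows in k variables, split by the sign
-- of their leading coefficient, and the primed registers the rows that a loop
-- has already visited. The blocks left and right receive the rows being read,
-- and unknown the solution.
data Block : Set where
  left right unknown : Block

data Kind : Set where
  input input′ tmp pos pos′ neg neg′ : Kind
  var : Block → Kind

Reg : Set
Reg = Kind × ℕ

rank : Kind → ℕ
rank input   = 0
rank input′  = 1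
rank tmp     = 2
rank pos     = 3
rank pos′    = 4
rank neg     = 5
rank neg′    = 6
rank (var left) = 7
rank (var right) = 8
rank (var unknown) = 9

unrank : ℕ → Kind
unrank 0 = input
unrank 1 = input′
unrank 2 = tmp
unrank 3 = pos
unrank 4 = pos′
unrank 5 = neg
unrank 6 = neg′
unrank 7 = var left
unrank 8 = var right
unrank _ = var unknown

unrank-rank : ∀ κ → unrank (rank κ ℕ.% 10) ≡ κ
unrank-rank input   = refl
unrank-rank input′  = refl
unrank-rank tmp     = refl
unrank-rank pos     = refl
unrank-rank pos′    = refl
unrank-rank neg     = refl
unrank-rank neg′    = refl
unrank-rank (var left) = refl
unrank-rank (var right) = refl
unrank-rank (var unknown) = refl

opaque
  -- The kind is the residue modulo 10, and the input is placed at register 0 as the calling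
  -- convention demands. Being opaque, codes do not unfold to arithmetic, and distinctness of
  -- registers is read off their names through `code-injective`.
  code : Reg → ℕ
  code (κ , i) = rank κ ℕ.+ i ℕ.* 10

  code-injective : ∀ {r s} → code r ≡ code s → r ≡ s
  code-injective {κ , i} {κ′ , j} eq with
    trans (sym (unrank-rank κ)) (trans (cong unrank (trans (sym (ℕ.[m+kn]%n≡m%n (rank κ) i 10))
      (trans (cong (ℕ._% 10) eq) (ℕ.[m+kn]%n≡m%n (rank κ′) j 10)))) (unrank-rank κ′))
  ... | refl = cong (κ ,_) (ℕ.*-cancelʳ-≡ i j 10 (ℕ.+-cancelˡ-≡ (rank κ) _ _ eq))

  code-input : code (input , 0) ≡ 0
  code-input = refl

Scratch : Reg → Set
Scratch (tmp , _) = ⊤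
Scratch _         = ⊥

Variable : Reg → Set
Variable (var _ , _) = ⊤
Variable _           = ⊥

ListReg : Reg → Set
ListReg r = ¬ Scratch r × ¬ Variable r

module Machine {a ℓ} (F : OrderedField a ℓ) where

  open OrderedField F renaming (Carrier to K)
  open Over F
  open FieldProperties F using (_-_; sum)
  open FourierMotzkin F

  infix 9 _at_
  _at_ : Store → Reg → List K
  σ at r = σ (code r)

  ≔-at : ∀ (σ : Store) r {xs} → (σ [ r ≔ xs ]) r ≡ xs
  ≔-at σ r with r ℕ.≟ r
  ... | yes _ = refl
  ... | no  n = ⊥-elim (n refl)

  ≔-other : ∀ (σ : Store) {r s xs} → r ≢ s → (σ [ r ≔ xs ]) s ≡ σ s
  ≔-other σ {r} {s} r≢s with r ℕ.≟ s
  ... | yes e = ⊥-elim (r≢s e)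
  ... | no  _ = refl

  ≔-at-other : ∀ (σ : Store) r s {xs} → r ≢ s → (σ [ code r ≔ xs ]) at s ≡ σ at s
  ≔-at-other σ r s n = ≔-other σ (n ∘ code-injective {r} {s})

  Top : Store → Reg → K → Set a
  Top σ r x = ∃[ xs ] σ at r ≡ x ∷ xs

  Writes : (Reg → Set) → ℕ → Set
  Writes W n = ∃[ r ] W r × code r ≡ n

  Only : (Reg → Set) → Program → Set
  Only W skip                 = ⊤
  Only W (p ⨾ q)              = Only W p × Only W q
  Only W (push r x)           = Writes W r
  Only W (drop r)             = Writes W r
  Only W (copy r s)           = Writes W s
  Only W (arith o r s u)      = Writes W u
  Only W (if c then p else q) = Only W p × Only W q
  Only W (while c loop p)     = Only W p
  Only W (call r s)           = Writes W s

  only-mono : ∀ {W W′ : Reg → Set} → (∀ {r} → W r → W′ r) → ∀ p → Only W p → Only W′ p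
  only-mono f skip                 _             = tt
  only-mono f (p ⨾ q)              (x , y)       = only-mono f p x , only-mono f q y
  only-mono f (push r x)           (s , w , e)   = s , f w , e
  only-mono f (drop r)             (s , w , e)   = s , f w , e
  only-mono f (copy r _)           (s , w , e)   = s , f w , e
  only-mono f (arith o r _ u)      (s , w , e)   = s , f w , e
  only-mono f (if c then p else q) (x , y)       = only-mono f p x , only-mono f q y
  only-mono f (while c loop p)     x             = only-mono f p x
  only-mono f (call r _)           (s , w , e)   = s , f w , e

  Same : (Reg → Set) → Store → Store → Set a
  Same W σ σ′ = ∀ r → ¬ W r → σ′ at r ≡ σ at r

  same-write : ∀ {W : Reg → Set} (σ : Store) {n xs} → Writes W n → Same W σ (σ [ n ≔ xs ])
  same-write σ (s , w , refl) r n = ≔-at-other σ s r λ { refl → n w }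

  same-trans : ∀ {W : Reg → Set} {σ σ′ σ″} → Same W σ σ′ → Same W σ′ σ″ → Same W σ σ″
  same-trans f g r n = trans (g r n) (f r n)

  frame : ∀ {O W p σ σ′ t k} → Only W p → Exec O p σ σ′ t k → Same W σ σ′
  frame o       skip           r n = refl
  frame (o , q) (seq {σ = σ} {σ′ = σ′} {σ″ = σ″} x y) r n = trans (frame q y r n) (frame o x r n)
  frame {σ = σ} o (push)       r n = same-write σ o r n
  frame {σ = σ} o (drop _)     r n = same-write σ o r n
  frame {σ = σ} o (copy _)     r n = same-write σ o r n
  frame {σ = σ} o (arith _ _ _) r n = same-write σ o r n
  frame (o , _) (if-true _ x)  r n = frame o x r n
  frame (_ , o) (if-false _ x) r n = frame o x r n
  frame o       (done _)       r n = refl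
  frame o       (iterate _ x y) r n = trans (frame o y r n) (frame o x r n)
  frame {σ = σ} o (call _)     r n = same-write σ o r n

  -- An upper bound on the running time when every loop makes at most L
  -- iterations.
  maxTime : ℕ → Program → ℕ
  maxTime L skip                 = 1
  maxTime L (p ⨾ q)              = maxTime L p ℕ.+ maxTime L q
  maxTime L (push r x)           = 1
  maxTime L (drop r)             = 1
  maxTime L (copy r s)           = 1
  maxTime L (arith o r s u)      = 1
  maxTime L (if c then p else q) = 1 ℕ.+ (maxTime L p ℕ.+ maxTime L q)
  maxTime L (while c loop p)     = 1 ℕ.+ L ℕ.* (1 ℕ.+ maxTime L p)
  maxTime L (call r s)           = 1

  module WeakestPrecondition (O : Oracle) (L : ℕ) where

    -- Total correctness together with a time bound. The call count is fixed at 0, so that all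
    -- oracle calls of the algorithm lie outside the parts verified in this way.
    WP : ∀ {q} → Program → (Store → Set q) → Store → Set (a ⊔ q)
    WP p Φ σ = ∃[ σ′ ] ∃[ t ] Exec O p σ σ′ t 0 × t ℕ.≤ maxTime L p × Φ σ′

    wp-map : ∀ {q r} {Φ : Store → Set q} {Ψ : Store → Set r} p {σ} → (∀ {σ′} → Φ σ′ → Ψ σ′) → WP p Φ σ → WP p Ψ σ
    wp-map p f (σ′ , t , x , t≤ , h) = σ′ , t , x , t≤ , f h

    wp-frame : ∀ {q} {Φ : Store → Set q} {W} p {σ} → Only W p → WP p Φ σ → WP p (λ σ′ → Φ σ′ × Same W σ σ′) σ
    wp-frame p o (σ′ , t , x , t≤ , h) = σ′ , t , x , t≤ , h , frame o x

    wp-seq : ∀ {q} {Φ : Store → Set q} p p′ {σ} → WP p (WP p′ Φ) σ → WP (p ⨾ p′) Φ σ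
    wp-seq p p′ (σ′ , t , x , t≤ , σ″ , t′ , x′ , t′≤ , h) =
      σ″ , t ℕ.+ t′ , seq x x′ , ℕ.+-mono-≤ t≤ t′≤ , h

    -- Sequencing with the frame built in: the second program may rely on every register that the
    -- first one syntactically cannot write.
    wp-then : ∀ {q r} {Φ : Store → Set q} {Ψ : Store → Set r} {W} p p′ {σ} → Only W p → WP p Φ σ →
      (∀ {σ′} → Φ σ′ → Same W σ σ′ → WP p′ Ψ σ′) → WP (p ⨾ p′) Ψ σ
    wp-then p p′ o h f = wp-seq p p′ (wp-map p (λ (x , s) → f x s) (wp-frame p o h))

    wp-skip : ∀ {q} {Φ : Store → Set q} {σ} → Φ σ → WP skip Φ σ
    wp-skip h = _ , 1 , skip , ℕ.≤-refl , h

    -- The index of `Stage` is the exact number of iterations still to come. It is the termination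
    -- measure, and its initial value bounds the running time.
    wp-while : ∀ {q c p} (Stage : ℕ → Store → Set q) →
      (∀ {m σ} → Stage (suc m) σ → Eval σ c true × WP p (Stage m) σ) →
      (∀ {σ} → Stage zero σ → Eval σ c false) →
      ∀ m {σ} → m ℕ.≤ L → Stage m σ → WP (while c loop p) (Stage zero) σ
    wp-while {c = c} {p} Stage body exit m {σ} m≤L j with go m j
      where
      go : ∀ m {σ} → Stage m σ → ∃[ σ′ ] ∃[ t ] Exec O (while c loop p) σ σ′ t 0 × t ℕ.≤ 1 ℕ.+ m ℕ.* (1 ℕ.+ maxTime L p) × Stage zero σ′
      go zero    j = _ , 1 , done (exit j) , ℕ.≤-refl , j
      go (suc m) j with body j
      ... | ev , σ₁ , t₁ , x₁ , t₁≤ , j₁ with go m j₁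
      ...   | σ₂ , t₂ , x₂ , t₂≤ , j₂ = σ₂ , _ , iterate ev x₁ x₂ ,
        ℕ.≤-trans (ℕ.+-mono-≤ (s≤s t₁≤) t₂≤) (ℕ.≤-reflexive (ℕ.+-suc (suc (maxTime L p)) _)) , j₂
    ... | σ′ , t , x , t≤ , h = σ′ , t , x , ℕ.≤-trans t≤ (s≤s (ℕ.*-monoˡ-≤ _ m≤L)) , h

  -- Compiled expressions and loops over lists of rows

  data Expr : Set a where
    get : Block → ℕ → Expr
    lit : K → Expr
    op  : Op → Expr → Expr → Expr

  data Val (σ : Store) : Expr → K → Set a where
    get : ∀ {b i x} → Top σ (var b , i) x → Val σ (get b i) x
    lit : ∀ {x} → Val σ (lit x) x
    op  : ∀ {o e e′ x y z} → Val σ e x → Val σ e′ y → ⟦ o ⟧ x , y ↦ z → Val σ (op o e e′) z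

  Vals : ∀ {n} → Store → Vector Expr n → Vector K n → Set a
  Vals σ es xs = ∀ i → Val σ (es i) (xs i)

  val-resp : ∀ {σ σ′ e x} → (∀ b i → σ′ at (var b , i) ≡ σ at (var b , i)) → Val σ e x → Val σ′ e x
  val-resp h (get {b} {i} (xs , eq)) = get (xs , trans (h b i) eq)
  val-resp h lit             = lit
  val-resp h (op v w o)      = op (val-resp h v) (val-resp h w) o

  compile : Expr → ℕ → Program
  compile (get b j)    i = copy (code (var b , j)) (code (tmp , i))
  compile (lit x)      i = push (code (tmp , i)) x
  compile (op o e e′)  i = compile e i ⨾ compile e′ (suc i) ⨾
                           arith o (code (tmp , i)) (code (tmp , suc i)) (code (tmp , i))

  -- Scratch registers are used as an evaluation stack: computing the second operand from index
  -- `suc i` on leaves the first one, at index `i`, intact.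
  ScratchFrom : ℕ → Reg → Set
  ScratchFrom i (tmp , j) = i ℕ.≤ j
  ScratchFrom i _         = ⊥

  scratchFrom⇒scratch : ∀ {i r} → ScratchFrom i r → Scratch r
  scratchFrom⇒scratch {r = tmp , _} _ = tt

  compile-only : ∀ e i → Only (ScratchFrom i) (compile e i)
  compile-only (get b j)   i = (tmp , i) , ℕ.≤-refl , refl
  compile-only (lit x)     i = (tmp , i) , ℕ.≤-refl , refl
  compile-only (op o e e′) i = compile-only e i ,
    only-mono (λ {r} → weaken {r}) (compile e′ (suc i)) (compile-only e′ (suc i)) , (tmp , i) , ℕ.≤-refl , refl
    where
    weaken : ∀ {r} → ScratchFrom (suc i) r → ScratchFrom i r
    weaken {tmp , _} h = ℕ.≤-trans (ℕ.n≤1+n i) h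

  compile-scratch : ∀ e i → Only Scratch (compile e i)
  compile-scratch e i = only-mono (λ {r} → scratchFrom⇒scratch {i} {r}) (compile e i) (compile-only e i)

  set : Reg → Expr → Program
  set r e = compile e 0 ⨾ copy (code (tmp , 0)) (code r)

  infixr 4 _∪_
  _∪_ : (Reg → Set) → (Reg → Set) → Reg → Set
  (W ∪ W′) r = W r ⊎ W′ r

  set-only : ∀ r e → Only ((r ≡_) ∪ Scratch) (set r e)
  set-only r e = only-mono inj₂ (compile e 0) (compile-scratch e 0) , r , inj₁ refl , refl

  -- The last entry is pushed first, so that the row reads from the top of the stack in its own
  -- order.
  pushes : ∀ {n} → Reg → Vector Expr n → Program
  pushes {zero}  r es = skip
  pushes {suc n} r es = pushes r (tail es) ⨾ set r (head es)

  pushes-only : ∀ {n} r (es : Vector Expr n) → Only ((r ≡_) ∪ Scratch) (pushes r es)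
  pushes-only {zero}  r es = tt
  pushes-only {suc n} r es = pushes-only r (tail es) , set-only r (head es)

  ifleq : Expr → Expr → Program → Program → Program
  ifleq e e′ p q = compile e 0 ⨾ compile e′ 1 ⨾ if leq (code (tmp , 0)) (code (tmp , 1)) then p else q

  ifleq-only : ∀ {W : Reg → Set} e e′ p q → (∀ {r} → Scratch r → W r) → Only W p → Only W q → Only W (ifleq e e′ p q)
  ifleq-only e e′ _ _ f p q = only-mono f (compile e 0) (compile-scratch e 0) , only-mono f (compile e′ 1) (compile-scratch e′ 1) , p , q

  -- Reading a stack destroys it. Each entry is therefore also saved on `l′`, in reverse order, and
  -- `restore` turns the saved stack back.
  pop : Reg → Reg → Block → ℕ → ℕ → Program
  pop l l′ b j zero    = skip
  pop l l′ b j (suc w) = copy (code l) (code (var b , j)) ⨾ copy (code l) (code l′) ⨾ drop (code l) ⨾ pop l l′ b (suc j) w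

  VarsFrom : Block → ℕ → Reg → Set
  VarsFrom b j r = ∃[ i ] j ℕ.≤ i × r ≡ (var b , i)

  Cursor : Reg → Reg → Block → ℕ → Reg → Set
  Cursor l l′ b j = (l ≡_) ∪ (l′ ≡_) ∪ VarsFrom b j

  cursor-suc : ∀ {l l′ b j r} → Cursor l l′ b (suc j) r → Cursor l l′ b j r
  cursor-suc (inj₁ e) = inj₁ e
  cursor-suc (inj₂ (inj₁ e)) = inj₂ (inj₁ e)
  cursor-suc (inj₂ (inj₂ (i , j≤i , e))) = inj₂ (inj₂ (i , ℕ.≤-trans (ℕ.n≤1+n _) j≤i , e))

  pop-only : ∀ l l′ b j w → Only (Cursor l l′ b j) (pop l l′ b j w)
  pop-only l l′ b j zero    = tt
  pop-only l l′ b j (suc w) =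
    (_ , inj₂ (inj₂ (j , ℕ.≤-refl , refl)) , refl) , (l′ , inj₂ (inj₁ refl) , refl) , (l , inj₁ refl , refl) ,
    only-mono cursor-suc (pop l l′ b (suc j) w) (pop-only l l′ b (suc j) w)

  each : Reg → Reg → Block → ℕ → Program → Program
  each l l′ b w body = while nonEmpty (code l) loop (pop l l′ b 0 w ⨾ body)

  restore : Reg → Reg → Program
  restore l l′ = while nonEmpty (code l′) loop (copy (code l′) (code l) ⨾ drop (code l′))

  traverse : Reg → Reg → Block → ℕ → Program → Program
  traverse l l′ b w body = each l l′ b w body ⨾ restore l l′

  each-only : ∀ {W : Reg → Set} l l′ b w body → (∀ {r} → Cursor l l′ b 0 r → W r) → Only W body → Only W (each l l′ b w body)
  each-only l l′ b w body f o = only-mono f (pop l l′ b 0 w) (pop-only l l′ b 0 w) , o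

  restore-only : ∀ l l′ → Only ((l ≡_) ∪ (l′ ≡_)) (restore l l′)
  restore-only l l′ = (l , inj₁ refl , refl) , l′ , inj₂ refl , refl

  traverse-only : ∀ {W : Reg → Set} l l′ b w body → (∀ {r} → Cursor l l′ b 0 r → W r) → Only W body → Only W (traverse l l′ b w body)
  traverse-only l l′ b w body f o = each-only l l′ b w body f o , only-mono (f ∘ λ { (inj₁ e) → inj₁ e ; (inj₂ e) → inj₂ (inj₁ e) }) (restore l l′) (restore-only l l′)

  flatten : ∀ {w} → List (Vector K w) → List K
  flatten = concatMap tabulate

  length-flatten : ∀ {w} (rows : List (Vector K w)) → length (flatten rows) ≡ length rows ℕ.* w
  length-flatten []         = refl
  length-flatten (r ∷ rows) = trans (length-++ (tabulate r)) (cong₂ ℕ._+_ (length-tabulate r) (length-flatten rows))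

  block : ∀ {w} → Block → Vector Expr w
  block b i = get b (toℕ i)

  emit : ∀ k → Vector Expr (suc k) → Program
  emit k es = ifleq (head es) (lit 0#) (pushes (neg , k) es) (pushes (pos , k) es)

  Emission : ℕ → Reg → Set
  Emission k = ((neg , k) ≡_) ∪ ((pos , k) ≡_) ∪ Scratch

  emit-only : ∀ k es → Only (Emission k) (emit k es)
  emit-only k es = ifleq-only (head es) (lit 0#) (pushes (neg , k) es) (pushes (pos , k) es) (inj₂ ∘ inj₂)
    (only-mono (λ { (inj₁ e) → inj₁ e ; (inj₂ s) → inj₂ (inj₂ s) }) (pushes (neg , k) es) (pushes-only (neg , k) es))
    (only-mono (λ { (inj₁ e) → inj₂ (inj₁ e) ; (inj₂ s) → inj₂ (inj₂ s) }) (pushes (pos , k) es) (pushes-only (pos , k) es))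

  Holds : ∀ k → List (Row k) → Store → Set a
  Holds k rows σ = σ at (pos , k) ≡ flatten (positive rows) × σ at (neg , k) ≡ flatten (nonPositive rows)

  -- Specifications of the compiled expressions and loops

  module Rules (O : Oracle) (L : ℕ) where

    open WeakestPrecondition O L

    compile-wp : ∀ {σ e x} i → Val σ e x → WP (compile e i) (λ σ′ → Top σ′ (tmp , i) x) σ
    compile-wp {σ} i (get (xs , eq)) = _ , 1 , copy eq , ℕ.≤-refl , σ at (tmp , i) , ≔-at σ (code (tmp , i))
    compile-wp {σ} i lit             = _ , 1 , push , ℕ.≤-refl , σ at (tmp , i) , ≔-at σ (code (tmp , i))
    compile-wp {σ} {op o e e′} i (op v w r) =
      wp-then (compile e i) _ (compile-only e i) (compile-wp i v) λ { {σ₁} (xs , eq) s →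
      wp-then (compile e′ (suc i)) _ (compile-only e′ (suc i)) (compile-wp (suc i) (val-resp (λ b j → s (var b , j) id) w)) λ { {σ₂} (ys , eq′) s′ →
      _ , 1 , arith (trans (s′ (tmp , i) (ℕ.<⇒≱ ℕ.≤-refl)) eq) eq′ r , ℕ.≤-refl , σ₂ at (tmp , i) , ≔-at σ₂ (code (tmp , i)) } }

    set-wp : ∀ {σ e x} r → ¬ Scratch r → Val σ e x → WP (set r e) (λ σ′ → σ′ at r ≡ x ∷ σ at r) σ
    set-wp {σ} {e} r n v = wp-then (compile e 0) _ (compile-scratch e 0) (compile-wp 0 v) λ { {σ₁} (xs , eq) s →
      _ , 1 , copy eq , ℕ.≤-refl , trans (≔-at σ₁ (code r)) (cong (_ ∷_) (s r n)) }

    pushes-wp : ∀ {n σ} {es : Vector Expr n} {xs} r → ListReg r → Vals σ es xs →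
      WP (pushes r es) (λ σ′ → σ′ at r ≡ tabulate xs ++ σ at r) σ
    pushes-wp {zero}  r n v = wp-skip refl
    pushes-wp {suc _} {es = es} r (n , n′) v =
      wp-then (pushes r (tail es)) (set r (head es)) (pushes-only r (tail es)) (pushes-wp r (n , n′) (v ∘ suc)) λ eq s →
      wp-map (set r (head es)) (λ eq′ → trans eq′ (cong (_ ∷_) eq))
        (set-wp r n (val-resp (λ b i → s (var b , i) λ { (inj₁ refl) → n′ tt ; (inj₂ ()) }) (v zero)))

    ifleq-wp : ∀ {q} {Φ : Store → Set q} {σ e e′ x y} p p′ → Val σ e x → Val σ e′ y →
      (∀ {σ′} → Same Scratch σ σ′ → x ≤ y → WP p Φ σ′) →
      (∀ {σ′} → Same Scratch σ σ′ → ¬ x ≤ y → WP p′ Φ σ′) →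
      WP (ifleq e e′ p p′) Φ σ
    ifleq-wp {Φ = Φ} {σ} {e} {e′} {x} {y} p p′ v w f g =
      wp-then (compile e 0) _ (compile-only e 0) (compile-wp 0 v) λ { {σ₁} (xs , eq) s →
      wp-then (compile e′ 1) _ (compile-only e′ 1) (compile-wp 1 (val-resp (λ b j → s (var b , j) id) w)) λ { {σ₂} (ys , eq′) s′ →
      branch (trans (s′ (tmp , 0) λ ()) eq) eq′
        (same-trans {σ = σ} {σ₁} {σ₂} (λ r n → s r (n ∘ scratchFrom⇒scratch {r = r})) (λ r n → s′ r (n ∘ scratchFrom⇒scratch {r = r}))) } }
      where
      branch : ∀ {σ₂ xs ys} → σ₂ at (tmp , 0) ≡ x ∷ xs → σ₂ at (tmp , 1) ≡ y ∷ ys → Same Scratch σ σ₂ →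
        WP (if leq (code (tmp , 0)) (code (tmp , 1)) then p else p′) Φ σ₂
      branch {σ₂} eq eq′ s with leq {σ = σ₂} eq eq′
      ... | ev with x ≤? y
      ...   | yes le with f s le
      ...     | σ′ , t , ex , t≤ , h = σ′ , _ , if-true ev ex , s≤s (ℕ.≤-trans t≤ (ℕ.m≤m+n _ _)) , h
      branch {σ₂} eq eq′ s | ev | no gt with g s gt
      ...     | σ′ , t , ex , t≤ , h = σ′ , _ , if-false ev ex , s≤s (ℕ.≤-trans t≤ (ℕ.m≤n+m _ (maxTime L p))) , h

    emit-wp : ∀ {σ} k {es : Vector Expr (suc k)} {row rows} → Vals σ es row → Holds k rows σ →
      WP (emit k es) (Holds k (row ∷ rows)) σ
    emit-wp k {es} {row} {rows} v (p , n) = ifleq-wp (pushes (neg , k) es) (pushes (pos , k) es) (v zero) lit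
      (λ {σ′} s le → wp-map (pushes (neg , k) es)
        (λ { (eq , s′) → trans (s′ (pos , k) λ { (inj₁ ()) ; (inj₂ ()) }) (trans (s (pos , k) id) (trans p (cong flatten (sym (filter-reject (λ p → ¬? (head p ≤? 0#)) {xs = rows} (λ c → c le))))))
          , trans eq (trans (cong (tabulate row ++_) (trans (s (neg , k) id) n)) (cong flatten (sym (filter-accept (λ p → head p ≤? 0#) {xs = rows} le)))) })
        (wp-frame (pushes (neg , k) es) (pushes-only (neg , k) es) (pushes-wp (neg , k) (id , id) (λ i → val-resp (λ b j → s (var b , j) id) (v i)))))
      (λ {σ′} s gt → wp-map (pushes (pos , k) es)
        (λ { (eq , s′) → trans eq (trans (cong (tabulate row ++_) (trans (s (pos , k) id) p)) (cong flatten (sym (filter-accept (λ p → ¬? (head p ≤? 0#)) {xs = rows} gt))))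
          , trans (s′ (neg , k) λ { (inj₁ ()) ; (inj₂ ()) }) (trans (s (neg , k) id) (trans n (cong flatten (sym (filter-reject (λ p → head p ≤? 0#) {xs = rows} gt))))) })
        (wp-frame (pushes (pos , k) es) (pushes-only (pos , k) es) (pushes-wp (pos , k) (id , id) (λ i → val-resp (λ b j → s (var b , j) id) (v i)))))

    pop-wp : ∀ {w σ rest} {row : Vector K w} l l′ b j → l ≢ l′ → ¬ Variable l → ¬ Variable l′ →
      σ at l ≡ tabulate row ++ rest →
      WP (pop l l′ b j w) (λ σ′ → σ′ at l ≡ rest × σ′ at l′ ≡ tabulate row ʳ++ σ at l′ ×
                                  (∀ i → Top σ′ (var b , j ℕ.+ toℕ i) (row i))) σ
    pop-wp {zero}  l l′ b j _ _ _ eq = wp-skip (eq , refl , λ ())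
    pop-wp {suc w} {σ} {rest} {row} l l′ b j l≢l′ nl nl′ eq =
      wp-seq (copy (code l) (code r)) _ (σ₁ , 1 , copy eq , ℕ.≤-refl ,
      wp-seq (copy (code l) (code l′)) _ (σ₂ , 1 , copy eq₁ , ℕ.≤-refl ,
      wp-seq (drop (code l)) _ (σ₃ , 1 , drop eq₂ , ℕ.≤-refl ,
      wp-map (pop l l′ b (suc j) w)
        (λ { {σ′} ((e , e′ , tops) , s) → e , trans e′ (cong (tabulate (tail row) ʳ++_) l′₃) , λ
           { zero → subst (λ m → Top σ′ (var b , m) (head row)) (sym (ℕ.+-identityʳ j))
                      (σ at r , trans (s r unread) r₃)
           ; (suc i) → subst (λ m → Top σ′ (var b , m) (row (suc i))) (sym (ℕ.+-suc j (toℕ i))) (tops i) } })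
        (wp-frame (pop l l′ b (suc j) w) (pop-only l l′ b (suc j) w) (pop-wp l l′ b (suc j) l≢l′ nl nl′ (≔-at σ₂ (code l)))))))
      where
      r = (var b , j)
      σ₁ = σ [ code r ≔ head row ∷ σ at r ]
      eq₁ : σ₁ at l ≡ head row ∷ _
      eq₁ = trans (≔-at-other σ r l λ { refl → nl tt }) eq
      σ₂ = σ₁ [ code l′ ≔ head row ∷ σ₁ at l′ ]
      eq₂ : σ₂ at l ≡ head row ∷ _
      eq₂ = trans (≔-at-other σ₁ l′ l (l≢l′ ∘ sym)) eq₁
      σ₃ = σ₂ [ code l ≔ tabulate (tail row) ++ rest ]
      l′₃ : σ₃ at l′ ≡ head row ∷ σ at l′
      l′₃ = trans (≔-at-other σ₂ l l′ l≢l′) (trans (≔-at σ₁ (code l′)) (cong (head row ∷_) (≔-at-other σ r l′ λ { refl → nl′ tt })))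
      r₃ : σ₃ at r ≡ head row ∷ σ at r
      r₃ = trans (≔-at-other σ₂ l r λ { refl → nl tt }) (trans (≔-at-other σ₁ l′ r λ { refl → nl′ tt }) (≔-at σ (code r)))
      unread : ¬ Cursor l l′ b (suc j) r
      unread (inj₁ refl) = nl tt
      unread (inj₂ (inj₁ refl)) = nl′ tt
      unread (inj₂ (inj₂ (i , lt , refl))) = ℕ.<-irrefl refl lt

    restore-wp : ∀ {σ} l l′ → l ≢ l′ → length (σ at l′) ℕ.≤ L →
      WP (restore l l′) (λ σ′ → σ′ at l ≡ σ at l′ ʳ++ σ at l × σ′ at l′ ≡ []) σ
    restore-wp {σ} l l′ l≢l′ len = wp-map (restore l l′)
      (λ { ([] , _ , e′ , e) → e , e′ })
      (wp-while Stage
        (λ { {σ = σ₁} (x ∷ xs , len , e′ , e) → cons e′ ,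
          wp-seq (copy (code l′) (code l)) _ (_ , 1 , copy e′ , ℕ.≤-refl ,
            _ , 1 , drop (trans (≔-at-other σ₁ l l′ l≢l′) e′) , ℕ.≤-refl ,
            xs , ℕ.suc-injective len , ≔-at (σ₁ [ code l ≔ x ∷ σ₁ at l ]) (code l′) ,
            trans (cong (xs ʳ++_) (trans (≔-at-other (σ₁ [ code l ≔ x ∷ σ₁ at l ]) l′ l (l≢l′ ∘ sym)) (≔-at σ₁ (code l)))) e) })
        (λ { ([] , _ , e′ , _) → empty e′ })
        (length (σ at l′)) len (σ at l′ , refl , refl , refl))
      where
      Stage : ℕ → Store → Set a
      Stage m σ₁ = ∃[ xs ] length xs ≡ m × σ₁ at l′ ≡ xs × xs ʳ++ σ₁ at l ≡ σ at l′ ʳ++ σ at l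

    -- Rows have positive width, so a nonempty stack means that a row is left. `Inv` depends on the
    -- rows already visited, latest first, which is why it ends at `reverse rows`. The bound `fits`
    -- counts entries, as `restore` moves one entry per iteration.
    module Loop {q w} {W : Reg → Set} (l l′ : Reg) (b : Block) {body : Program} (rows : List (Vector K (suc w)))
      (Inv : List (Vector K (suc w)) → Store → Set q)
      (l≢l′ : l ≢ l′) (nl : ¬ Variable l) (nl′ : ¬ Variable l′)
      (only : Only W body) (Wl : ¬ W l) (Wl′ : ¬ W l′)
      (resp : ∀ {past σ σ′} → Same (Cursor l l′ b 0) σ σ′ → Inv past σ → Inv past σ′)
      (step : ∀ {past row σ} → row ∈ₗ rows → Vals σ (block b) row → Inv past σ → WP body (Inv (row ∷ past)) σ)
      (fits : length (flatten rows) ℕ.≤ L)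
      where

      each-wp : ∀ {σ} → σ at l ≡ flatten rows → Inv [] σ →
        WP (each l l′ b (suc w) body) (λ σ′ → Inv (reverse rows) σ′ × σ′ at l ≡ [] × σ′ at l′ ≡ flatten rows ʳ++ σ at l′) σ
      each-wp {σ} eq inv = wp-map (each l l′ b (suc w) body)
        (λ { {σ′} ([] , _ , _ , _ , e , e′ , dn , i) → subst (λ d → Inv d σ′) dn i , e , e′ })
        (wp-while Stage
          (λ { {σ = σ₁} (row ∷ rest , len , past , incl , e , e′ , dn , i) → cons e ,
            wp-then (pop l l′ b 0 (suc w)) body (pop-only l l′ b 0 (suc w)) (pop-wp {row = row} l l′ b 0 l≢l′ nl nl′ e) λ (e₁ , e₁′ , tops) s →
            wp-map body (λ (i′ , s′) → rest , ℕ.suc-injective len , row ∷ past , (λ p → incl p ∘ there) , trans (s′ l Wl) e₁ ,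
                trans (cong (flatten rest ʳ++_) (trans (s′ l′ Wl′) e₁′)) (trans (sym (++-ʳ++ (tabulate row) {flatten rest})) e′) , dn , i′)
              (wp-frame body only (step (incl row (here refl)) (λ i → get (tops i)) (resp s i))) })
          (λ { ([] , _ , _ , _ , e , _) → empty e })
          (length rows) (ℕ.≤-trans length≤ fits) (rows , refl , [] , (λ _ → id) , eq , refl , refl , inv))
        where
        length≤ : length rows ℕ.≤ length (flatten rows)
        length≤ = subst (length rows ℕ.≤_) (sym (length-flatten rows)) (ℕ.m≤m*n (length rows) (suc w))
        Stage : ℕ → Store → Set _
        Stage m σ₁ = ∃[ rest ] length rest ≡ m × (∃[ past ] (∀ p → p ∈ₗ rest → p ∈ₗ rows) × σ₁ at l ≡ flatten rest ×
          flatten rest ʳ++ σ₁ at l′ ≡ flatten rows ʳ++ σ at l′ × rest ʳ++ past ≡ reverse rows × Inv past σ₁)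

      traverse-wp : ∀ {σ} → σ at l ≡ flatten rows → σ at l′ ≡ [] → Inv [] σ →
        WP (traverse l l′ b (suc w) body) (λ σ′ → Inv (reverse rows) σ′ × σ′ at l ≡ flatten rows × σ′ at l′ ≡ []) σ
      traverse-wp {σ} eq eq′ inv = wp-seq (each l l′ b (suc w) body) (restore l l′) (wp-map (each l l′ b (suc w) body)
        (λ { {σ₁} (i , e , e′) → wp-map (restore l l′)
          (λ ((r , r′) , s) → resp (λ r n → s r λ { (inj₁ x) → n (inj₁ x) ; (inj₂ x) → n (inj₂ (inj₁ x)) }) i ,
             trans r (trans (cong₂ _ʳ++_ (trans e′ (cong (flatten rows ʳ++_) eq′)) e)
               (trans (ʳ++-ʳ++ (flatten rows)) (++-identityʳ (flatten rows)))) , r′)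
          (wp-frame (restore l l′) (restore-only l l′) (restore-wp l l′ l≢l′
            (subst (ℕ._≤ L) (sym (trans (cong length (trans e′ (cong (flatten rows ʳ++_) eq′))) (trans (length-ʳ++ (flatten rows)) (ℕ.+-identityʳ _)))) fits))) })
        (each-wp eq inv))

-- Elimination and back-substitution on the machine

length-cartesianProductWith : ∀ {a b c} {A : Set a} {B : Set b} {C : Set c} (f : A → B → C) xs ys →
  length (cartesianProductWith f xs ys) ≡ length xs ℕ.* length ys
length-cartesianProductWith f []       ys = refl
length-cartesianProductWith f (x ∷ xs) ys = trans (length-++ (map (f x) ys))
  (cong₂ ℕ._+_ (length-map (f x) ys) (length-cartesianProductWith f xs ys))

-- A bound on the number of stack entries that the elimination of k
-- variables from s rows puts on any one register.
capacity : ℕ → ℕ → ℕ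
capacity zero    s = s
capacity (suc k) s = suc s ℕ.* suc (suc k) ℕ.+ capacity k (suc s ℕ.* suc s)

module Elimination {a ℓ} (F : OrderedField a ℓ) where

  open OrderedField F renaming (Carrier to K)
  open Over F
  open FieldProperties F
  open FourierMotzkin F
  open Machine F

  length-positive : ∀ {k} (rows : List (Row k)) → length (positive rows) ℕ.≤ length rows
  length-positive = length-filter (λ p → ¬? (head p ≤? 0#))

  length-nonPositive : ∀ {k} (rows : List (Row k)) → length (nonPositive rows) ℕ.≤ length rows
  length-nonPositive = length-filter (λ p → head p ≤? 0#)

  length-eliminate : ∀ {k s} (rows : List (Row (suc k))) → length rows ℕ.≤ s →
    length (eliminate (bound ∷ rows)) ℕ.≤ suc s ℕ.* suc s
  length-eliminate {s = s} rows len = begin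
    length (eliminate rows⁺)                                               ≡⟨ length-cartesianProductWith combine (reverse (positive rows⁺)) (reverse (nonPositive rows⁺)) ⟩
    length (reverse (positive rows⁺)) ℕ.* length (reverse (nonPositive rows⁺))  ≡⟨ cong₂ ℕ._*_ (length-reverse (positive rows⁺)) (length-reverse (nonPositive rows⁺)) ⟩
    length (positive rows⁺) ℕ.* length (nonPositive rows⁺)                 ≤⟨ ℕ.*-mono-≤ (ℕ.≤-trans (length-positive rows⁺) (s≤s len)) (ℕ.≤-trans (length-nonPositive rows⁺) (s≤s len)) ⟩
    suc s ℕ.* suc s                                                        ∎
    where
    open ℕ.≤-Reasoning
    rows⁺ = bound ∷ rows

  combineE : ∀ {k} → Vector Expr (suc k)
  combineE i = op sub (op mul (get left 0) (get right (suc (toℕ i)))) (op mul (get right 0) (get left (suc (toℕ i))))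

  boundE : ∀ {k} → Vector Expr (suc (suc k))
  boundE = lit 1# ◂ λ _ → lit 0#

  combineAll : ℕ → Program
  combineAll k = traverse (neg , suc k) (neg′ , suc k) right (2 ℕ.+ k) (emit k combineE)

  -- Both nested loops restore what they read: the nonpositive rows are needed again for the next
  -- positive row, and the positive rows for the back-substitution.
  eliminateStep : ℕ → Program
  eliminateStep k = emit (suc k) boundE ⨾ traverse (pos , suc k) (pos′ , suc k) left (2 ℕ.+ k) (combineAll k)

  forward : ℕ → Program
  forward zero    = skip
  forward (suc k) = eliminateStep k ⨾ forward k

  Combining : ℕ → Reg → Set
  Combining k = Cursor (neg , suc k) (neg′ , suc k) right 0 ∪ Emission k

  combineAll-only : ∀ k → Only (Combining k) (combineAll k)
  combineAll-only k = traverse-only (neg , suc k) (neg′ , suc k) right (2 ℕ.+ k) (emit k combineE) inj₁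
    (only-mono inj₂ (emit k combineE) (emit-only k combineE))

  -- Level `suc k` is included although its rows survive: `bound` is pushed there, and the
  -- traversals empty and refill its registers.
  Eliminating : ℕ → Reg → Set
  Eliminating k (tmp  , _) = ⊤
  Eliminating k (var left , _) = ⊤
  Eliminating k (var right , _) = ⊤
  Eliminating k (pos  , j) = k ℕ.≤ j × j ℕ.≤ suc k
  Eliminating k (neg  , j) = k ℕ.≤ j × j ℕ.≤ suc k
  Eliminating k (pos′ , j) = j ≡ suc k
  Eliminating k (neg′ , j) = j ≡ suc k
  Eliminating k _          = ⊥

  emission⊆ : ∀ {k r} (W : Reg → Set) → W (neg , k) → W (pos , k) → (∀ i → W (tmp , i)) → Emission k r → W r
  emission⊆ W n p t (inj₁ refl)        = n
  emission⊆ W n p t (inj₂ (inj₁ refl)) = p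
  emission⊆ {r = tmp , i} W n p t (inj₂ (inj₂ _)) = t i

  cursor⊆ : ∀ {l l′ b r} (W : Reg → Set) → W l → W l′ → (∀ i → W (var b , i)) → Cursor l l′ b 0 r → W r
  cursor⊆ W wl wl′ wb (inj₁ refl)                  = wl
  cursor⊆ W wl wl′ wb (inj₂ (inj₁ refl))           = wl′
  cursor⊆ W wl wl′ wb (inj₂ (inj₂ (i , _ , refl))) = wb i

  eliminateStep-only : ∀ k → Only (Eliminating k) (eliminateStep k)
  eliminateStep-only k =
    only-mono (emission⊆ W (ℕ.n≤1+n k , ℕ.≤-refl) (ℕ.n≤1+n k , ℕ.≤-refl) (λ _ → tt)) (emit (suc k) boundE) (emit-only (suc k) boundE) ,
    traverse-only (pos , suc k) (pos′ , suc k) left (2 ℕ.+ k) (combineAll k)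
      (cursor⊆ W (ℕ.n≤1+n k , ℕ.≤-refl) refl (λ _ → tt))
      (only-mono [ cursor⊆ W (ℕ.n≤1+n k , ℕ.≤-refl) refl (λ _ → tt) ,
                   emission⊆ W (ℕ.≤-refl , ℕ.n≤1+n k) (ℕ.≤-refl , ℕ.n≤1+n k) (λ _ → tt) ]′ (combineAll k) (combineAll-only k))
    where W = Eliminating k

  Forward : ℕ → Reg → Set
  Forward k (input  , _)  = ⊥
  Forward k (input′ , _)  = ⊥
  Forward k (var unknown , _)   = ⊥
  Forward k (var _ , _)   = ⊤
  Forward k (tmp , _)     = ⊤
  Forward k (_ , j)       = j ℕ.≤ k

  eliminating⊆forward : ∀ {k r} → Eliminating k r → Forward (suc k) r
  eliminating⊆forward {r = tmp  , _} h = h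
  eliminating⊆forward {r = var left , _} h = h
  eliminating⊆forward {r = var right , _} h = h
  eliminating⊆forward {r = pos  , j} h = proj₂ h
  eliminating⊆forward {r = neg  , j} h = proj₂ h
  eliminating⊆forward {r = pos′ , j} refl = ℕ.≤-refl
  eliminating⊆forward {r = neg′ , j} refl = ℕ.≤-refl

  forward-suc : ∀ {k r} → Forward k r → Forward (suc k) r
  forward-suc {r = tmp  , _} h = h
  forward-suc {r = var left , _} h = h
  forward-suc {r = var right , _} h = h
  forward-suc {r = pos  , j} h = ℕ.≤-trans h (ℕ.n≤1+n _)
  forward-suc {r = neg  , j} h = ℕ.≤-trans h (ℕ.n≤1+n _)
  forward-suc {r = pos′ , j} h = ℕ.≤-trans h (ℕ.n≤1+n _)
  forward-suc {r = neg′ , j} h = ℕ.≤-trans h (ℕ.n≤1+n _)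

  forward-only : ∀ k → Only (Forward k) (forward k)
  forward-only zero    = tt
  forward-only (suc k) = only-mono (λ {r} → eliminating⊆forward {k} {r}) (eliminateStep k) (eliminateStep-only k) ,
                         only-mono (λ {r} → forward-suc {k} {r}) (forward k) (forward-only k)

  Fresh : ℕ → Store → Set a
  Fresh k σ = (∀ j → j ℕ.≤ k → σ at (pos′ , j) ≡ [] × σ at (neg′ , j) ≡ []) × (∀ j → j ℕ.< k → Holds j [] σ)

  -- The systems of all stages are in the store at once, because the back-substitution revisits them
  -- in the opposite order.
  Chain : ∀ k → List (Row k) → Store → Set a
  Chain zero    rows σ = Holds zero rows σ
  Chain (suc k) rows σ = Holds (suc k) (bound ∷ rows) σ × Chain k (eliminate (bound ∷ rows)) σ

  chain-final : ∀ k {rows σ} → Chain k rows σ → σ at (pos , 0) ≡ flatten (positive (final k rows))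
  chain-final zero    c = proj₁ c
  chain-final (suc k) c = chain-final k (proj₂ c)

  holds-resp : ∀ {k} rows {σ σ′} → σ′ at (pos , k) ≡ σ at (pos , k) → σ′ at (neg , k) ≡ σ at (neg , k) →
    Holds k rows σ → Holds k rows σ′
  holds-resp rows e e′ (p , n) = trans e p , trans e′ n

  -- Unknowns are numbered from the end. Eliminating the first variable then leaves the registers of
  -- the others unchanged.
  xE : ∀ k → Vector Expr k
  xE (suc k) zero    = get unknown k
  xE (suc k) (suc i) = xE k i

  xE-resp : ∀ k {σ σ′} {x : Vector K k} → (∀ j → j ℕ.< k → σ′ at (var unknown , j) ≡ σ at (var unknown , j)) →
    Vals σ (xE k) x → Vals σ′ (xE k) x
  xE-resp (suc k) h v zero with v zero
  ... | get (xs , eq) = get (xs , trans (h k ℕ.≤-refl) eq)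
  xE-resp (suc k) {σ} {σ′} h v (suc i) = xE-resp k {σ} {σ′} (λ j lt → h j (ℕ.<-trans lt ℕ.≤-refl)) (v ∘ suc) i

  affineE : ∀ {k} → Vector Expr (suc k) → Vector Expr k → Expr
  affineE {zero}  p x = head p
  affineE {suc k} p x = op add (op mul (head p) (head x)) (affineE (tail p) (tail x))

  affine-val : ∀ {k σ pE xE} {p : Row k} {x} → Vals σ pE p → Vals σ xE x → Val σ (affineE pE xE) (affine p x)
  affine-val {zero}  vp vx = vp zero
  affine-val {suc k} vp vx = op (op (vp zero) (vx zero) mul) (affine-val (vp ∘ suc) (vx ∘ suc)) add

  boundOn : ℕ → Expr
  boundOn k = op div (op sub (lit 0#) (affineE (λ i → get left (suc (toℕ i))) (xE k))) (get left 0)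

  tighten : ℕ → Program
  tighten k = ifleq (get unknown k) (boundOn k) skip (set (var unknown , k) (boundOn k))

  -- The start value 0 is the upper bound imposed by the row `bound`; the other positive rows can
  -- only lower it. The rows of this level are not read again, so `each` suffices without `restore`.
  minimise : ℕ → Program
  minimise k = set (var unknown , k) (lit 0#) ⨾ each (pos , suc k) (pos′ , suc k) left (2 ℕ.+ k) (tighten k)

  backward : ℕ → Program
  backward zero    = skip
  backward (suc k) = backward k ⨾ minimise k

  tighten-only : ∀ k → Only (((var unknown , k) ≡_) ∪ Scratch) (tighten k)
  tighten-only k = ifleq-only (get unknown k) (boundOn k) skip (set (var unknown , k) (boundOn k)) inj₂ tt (set-only (var unknown , k) (boundOn k))

  Backward : ℕ → Reg → Set
  Backward k (tmp   , _) = ⊤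
  Backward k (var left , _) = ⊤
  Backward k (var unknown , j) = j ℕ.< k
  Backward k (pos   , j) = j ℕ.≤ k
  Backward k (pos′  , j) = j ℕ.≤ k
  Backward k _           = ⊥

  backward-suc : ∀ {k r} → Backward k r → Backward (suc k) r
  backward-suc {r = tmp   , _} h = h
  backward-suc {r = var left , _} h = h
  backward-suc {r = var unknown , j} h = ℕ.<-trans h ℕ.≤-refl
  backward-suc {r = pos   , j} h = ℕ.≤-trans h (ℕ.n≤1+n _)
  backward-suc {r = pos′  , j} h = ℕ.≤-trans h (ℕ.n≤1+n _)

  backward-only : ∀ k → Only (Backward k) (backward k)
  backward-only zero    = tt
  backward-only (suc k) = only-mono (λ {r} → backward-suc {k} {r}) (backward k) (backward-only k) ,
    only-mono x⊆ (set (var unknown , k) (lit 0#)) (set-only (var unknown , k) (lit 0#)) ,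
    each-only (pos , suc k) (pos′ , suc k) left (2 ℕ.+ k) (tighten k)
      (cursor⊆ (Backward (suc k)) ℕ.≤-refl ℕ.≤-refl (λ _ → tt)) (only-mono x⊆ (tighten k) (tighten-only k))
    where
    x⊆ : ∀ {r} → (((var unknown , k) ≡_) ∪ Scratch) r → Backward (suc k) r
    x⊆ (inj₁ refl) = ℕ.≤-refl
    x⊆ {tmp , _} (inj₂ _) = tt

  module _ (O : Oracle) (L : ℕ) where

    open WeakestPrecondition O L
    open Rules O L

    fits : ∀ k {s} (rows rows′ : List (Row (suc k))) → length rows′ ℕ.≤ length rows → length rows ℕ.≤ suc s →
      capacity (suc k) s ℕ.≤ L → length (flatten rows′) ℕ.≤ L
    fits k {s} rows rows′ l₁ l₂ cap = begin
      length (flatten rows′)              ≡⟨ length-flatten rows′ ⟩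
      length rows′ ℕ.* (2 ℕ.+ k)          ≤⟨ ℕ.*-monoˡ-≤ (2 ℕ.+ k) (ℕ.≤-trans l₁ l₂) ⟩
      suc s ℕ.* (2 ℕ.+ k)                 ≤⟨ ℕ.m≤m+n _ _ ⟩
      capacity (suc k) s                  ≤⟨ cap ⟩
      L                                   ∎
      where open ℕ.≤-Reasoning

    combineAll-wp : ∀ k {p : Row (suc k)} negs base {σ} → length (flatten negs) ℕ.≤ L →
      σ at (neg , suc k) ≡ flatten negs → σ at (neg′ , suc k) ≡ [] → Vals σ (block left) p → Holds k base σ →
      WP (combineAll k) (λ σ′ → Holds k (map (combine p) (reverse negs) ++ base) σ′ ×
                                σ′ at (neg , suc k) ≡ flatten negs × σ′ at (neg′ , suc k) ≡ []) σ
    combineAll-wp k {p} negs base len eq eq′ vp lev = wp-map (combineAll k) (λ ((l , _) , e) → l , e)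
      (Loop.traverse-wp (neg , suc k) (neg′ , suc k) right negs
        (λ past σ → Holds k (map (combine p) past ++ base) σ × Vals σ (block left) p)
        (λ ()) id id (emit-only k combineE)
        (λ { (inj₁ ()) ; (inj₂ (inj₁ ())) ; (inj₂ (inj₂ ())) }) (λ { (inj₁ ()) ; (inj₂ (inj₁ ())) ; (inj₂ (inj₂ ())) })
        (λ {past} {σ} {σ′} s (l , v) →
          holds-resp {k} (map (combine p) past ++ base) {σ} {σ′}
            (s (pos , k) λ { (inj₁ ()) ; (inj₂ (inj₁ ())) ; (inj₂ (inj₂ (_ , _ , ()))) })
            (s (neg , k) λ { (inj₁ ()) ; (inj₂ (inj₁ ())) ; (inj₂ (inj₂ (_ , _ , ()))) }) l ,
          left-resp {σ} {σ′} (λ i → s (var left , i) λ { (inj₁ ()) ; (inj₂ (inj₁ ())) ; (inj₂ (inj₂ (_ , _ , ()))) }) v)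
        (λ {past} {q} {σ} _ vq (l , v) → wp-map (emit k combineE)
          (λ {σ′} (l′ , s) → l′ , left-resp {σ} {σ′} (λ i → s (var left , i) λ { (inj₁ ()) ; (inj₂ (inj₁ ())) ; (inj₂ (inj₂ ())) }) v)
          (wp-frame (emit k combineE) (emit-only k combineE)
            (emit-wp k {combineE} {combine p q} (λ i → op (op (v zero) (vq (suc i)) mul) (op (vq zero) (v (suc i)) mul) sub) l)))
        len eq eq′ (lev , vp))
      where
      left-resp : ∀ {σ σ′ w} {row : Vector K w} → (∀ i → σ′ at (var left , i) ≡ σ at (var left , i)) → Vals σ (block left) row → Vals σ′ (block left) row
      left-resp h v i with v i
      ... | get (xs , eq) = get (xs , trans (h (toℕ i)) eq)

    eliminateStep-wp : ∀ k {s} (rows : List (Row (suc k))) {σ} → length rows ℕ.≤ s → capacity (suc k) s ℕ.≤ L →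
      Holds (suc k) rows σ → Fresh (suc k) σ →
      WP (eliminateStep k) (λ σ′ → Holds (suc k) (bound ∷ rows) σ′ × Holds k (eliminate (bound ∷ rows)) σ′) σ
    eliminateStep-wp k rows {σ} len cap lev (fr′ , fr) =
      wp-then (emit (suc k) boundE) _ (emit-only (suc k) boundE)
        (emit-wp (suc k) {boundE} {bound} (λ { zero → lit ; (suc i) → lit }) lev) λ {σ₁} (p , n) s →
      wp-map (traverse (pos , suc k) (pos′ , suc k) left (2 ℕ.+ k) (combineAll k)) (λ ((l , e , _) , e′ , _) → (e′ , e) , l)
        (Loop.traverse-wp (pos , suc k) (pos′ , suc k) left ps
          (λ past σ → Holds k (cartesianProductWith combine past (reverse ns)) σ × σ at (neg , suc k) ≡ flatten ns × σ at (neg′ , suc k) ≡ [])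
          (λ ()) id id (combineAll-only k)
          (λ { (inj₁ (inj₁ ())) ; (inj₁ (inj₂ (inj₁ ()))) ; (inj₁ (inj₂ (inj₂ (_ , _ , ())))) ; (inj₂ (inj₁ ())) ; (inj₂ (inj₂ (inj₁ ()))) ; (inj₂ (inj₂ (inj₂ ()))) })
          (λ { (inj₁ (inj₁ ())) ; (inj₁ (inj₂ (inj₁ ()))) ; (inj₁ (inj₂ (inj₂ (_ , _ , ())))) ; (inj₂ (inj₁ ())) ; (inj₂ (inj₂ (inj₁ ()))) ; (inj₂ (inj₂ (inj₂ ()))) })
          (λ {past} {σ} {σ′} s (l , e , e′) →
            holds-resp {k} (cartesianProductWith combine past (reverse ns)) {σ} {σ′}
              (s (pos , k) λ { (inj₁ ()) ; (inj₂ (inj₁ ())) ; (inj₂ (inj₂ (_ , _ , ()))) })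
              (s (neg , k) λ { (inj₁ ()) ; (inj₂ (inj₁ ())) ; (inj₂ (inj₂ (_ , _ , ()))) }) l ,
            trans (s (neg , suc k) λ { (inj₁ ()) ; (inj₂ (inj₁ ())) ; (inj₂ (inj₂ (_ , _ , ()))) }) e ,
            trans (s (neg′ , suc k) λ { (inj₁ ()) ; (inj₂ (inj₁ ())) ; (inj₂ (inj₂ (_ , _ , ()))) }) e′)
          (λ {past} _ vp (l , e , e′) → combineAll-wp k ns (cartesianProductWith combine past (reverse ns))
            (fits k (bound ∷ rows) ns (length-nonPositive (bound ∷ rows)) (s≤s len) cap) e e′ vp l)
          (fits k (bound ∷ rows) ps (length-positive (bound ∷ rows)) (s≤s len) cap)
          p
          (trans (s (pos′ , suc k) λ { (inj₁ ()) ; (inj₂ (inj₁ ())) ; (inj₂ (inj₂ ())) }) (proj₁ (fr′ (suc k) ℕ.≤-refl)))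
          (holds-resp {k} [] {σ} {σ₁}
             (s (pos , k) λ { (inj₁ ()) ; (inj₂ (inj₁ ())) ; (inj₂ (inj₂ ())) })
             (s (neg , k) λ { (inj₁ ()) ; (inj₂ (inj₁ ())) ; (inj₂ (inj₂ ())) }) (fr k ℕ.≤-refl) ,
           n ,
           trans (s (neg′ , suc k) λ { (inj₁ ()) ; (inj₂ (inj₁ ())) ; (inj₂ (inj₂ ())) }) (proj₂ (fr′ (suc k) ℕ.≤-refl))))
      where
      ps = positive (bound ∷ rows)
      ns = nonPositive (bound ∷ rows)

    forward-wp : ∀ k {s} (rows : List (Row k)) {σ} → length rows ℕ.≤ s → capacity k s ℕ.≤ L →
      Holds k rows σ → Fresh k σ → WP (forward k) (Chain k rows) σ
    forward-wp zero    rows len cap lev fr = wp-skip lev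
    forward-wp (suc k) {s} rows {σ} len cap lev fr@(fr′ , fr″) =
      wp-then (eliminateStep k) (forward k) (eliminateStep-only k) (eliminateStep-wp k rows len cap lev fr) λ {σ₁} (l₁ , l₂) same →
      wp-map (forward k) (λ {σ₂} (ch , same′) →
          holds-resp {suc k} (bound ∷ rows) {σ₁} {σ₂} (same′ (pos , suc k) ℕ.1+n≰n) (same′ (neg , suc k) ℕ.1+n≰n) l₁ , ch)
        (wp-frame (forward k) (forward-only k)
          (forward-wp k (eliminate (bound ∷ rows)) (length-eliminate rows len) (ℕ.≤-trans (ℕ.m≤n+m _ (suc s ℕ.* suc (suc k))) cap) l₂
            ((λ j j≤k → trans (same (pos′ , j) λ { refl → ℕ.1+n≰n j≤k }) (proj₁ (fr′ j (ℕ.m≤n⇒m≤1+n j≤k))) ,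
                        trans (same (neg′ , j) λ { refl → ℕ.1+n≰n j≤k }) (proj₂ (fr′ j (ℕ.m≤n⇒m≤1+n j≤k)))) ,
             (λ j j<k → holds-resp {j} [] {σ} {σ₁} (same (pos , j) λ (k≤j , _) → ℕ.<⇒≱ j<k k≤j) (same (neg , j) λ (k≤j , _) → ℕ.<⇒≱ j<k k≤j)
                          (fr″ j (ℕ.m≤n⇒m≤1+n j<k))))))

    -- The sign of `head p` is part of the invariant because it makes lowering `t` harmless for the
    -- rows visited earlier.
    Tightest : ∀ {k} → List (Row (suc k)) → Vector K k → List (Row (suc k)) → Store → Set (a ⊔ ℓ)
    Tightest {k} rows x past σ = Vals σ (xE k) x × ∃[ t ] Top σ (var unknown , k) t ×
      (∀ {p} → p ∈ₗ past → 0# ≤ head p × affine p (t ◂ x) ≤ 0#) × (∃[ p ] p ∈ₗ positive rows × affine p (t ◂ x) ≡ 0#)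

    tighten-wp : ∀ {k rows x past p σ} → p ∈ₗ positive rows → Vals σ (block left) p → Tightest {k} rows x past σ →
      WP (tighten k) (Tightest rows x (p ∷ past)) σ
    tighten-wp {k} {rows} {x} {past} {p} {σ} p∈ vp (vx , t , (ts , top) , below , tight) =
      ifleq-wp skip (set (var unknown , k) (boundOn k)) (get {b = unknown} {i = k} (ts , top)) value
        (λ {σ₁} s t≤u → wp-skip (xE-resp k {σ} {σ₁} (λ j _ → s (var unknown , j) id) vx , t , (ts , trans (s (var unknown , k) id) top) ,
          (λ { (here refl) → proj₁ p>0 , subst (affine p (t ◂ x) ≤_) eq (affine-mono p (proj₁ p>0) t≤u) ; (there q∈) → below q∈ }) , tight))
        (λ {σ₁} s t≰u → wp-map (set (var unknown , k) (boundOn k))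
          (λ {σ₂} (e , s′) → xE-resp k {σ} {σ₂} (λ j lt → trans (s′ (var unknown , j) λ { (inj₁ refl) → ℕ.<-irrefl refl lt }) (s (var unknown , j) id)) vx ,
            u , (_ , e) ,
            (λ { (here refl) → proj₁ p>0 , ≤-reflexive eq
               ; {q} (there q∈) → proj₁ (below q∈) , ≤-trans (affine-mono q (proj₁ (below q∈)) (≰⇒≥ t≰u)) (proj₂ (below q∈)) }) ,
            (p , p∈ , eq))
          (wp-frame (set (var unknown , k) (boundOn k)) (set-only (var unknown , k) (boundOn k))
            (set-wp (var unknown , k) id (val-resp (λ b j → s (var b , j) id) value))))
      where
      p>0 : 0# < head p
      p>0 = ≰⇒< (proj₂ (∈-filter⁻ _ {xs = rows} p∈))
      u = (0# - affine (tail p) x) * head p ⁻¹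
      value : Val σ (boundOn k) u
      value = op (op lit (affine-val (λ i → vp (suc i)) vx) sub) (vp zero) (div (λ e → proj₂ p>0 (sym e)))
      eq : affine p (u ◂ x) ≡ 0#
      eq = begin
        head p * ((0# - v) * head p ⁻¹) + v   ≡⟨ solve 3 (λ p v i → p :* ((:0 :- v) :* i) :+ v := v :- p :* i :* v) refl (head p) v (head p ⁻¹) ⟩
        v - head p * head p ⁻¹ * v            ≡⟨ cong (λ w → v - w * v) (⁻¹-inverseʳ (head p) (λ e → proj₂ p>0 (sym e))) ⟩
        v - 1# * v                            ≡⟨ solve 1 (λ v → v :- :1 :* v := :0) refl v ⟩
        0#                                    ∎
        where
        open ≡-Reasoning
        v = affine (tail p) x
      affine-mono : ∀ q {t u} → 0# ≤ head q → t ≤ u → affine q (t ◂ x) ≤ affine q (u ◂ x)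
      affine-mono q q≥0 h = +-mono-≤ (*-monoˡ-≤ q≥0 h) ≤-refl

    minimise-wp : ∀ {k} rows (x : Vector K k) {σ} → Vals σ (xE k) x → σ at (pos , suc k) ≡ flatten (positive (bound ∷ rows)) →
      length (flatten (positive (bound ∷ rows))) ℕ.≤ L →
      WP (minimise k) (λ σ′ → ∃[ t ] Vals σ′ (xE (suc k)) (t ◂ x) × IsLeastBound (bound ∷ rows) x t) σ
    minimise-wp {k} rows x {σ} vx eq len =
      wp-then (set (var unknown , k) (lit 0#)) _ (set-only (var unknown , k) (lit 0#)) (set-wp (var unknown , k) id lit) λ {σ₁} e s →
      wp-map (each (pos , suc k) (pos′ , suc k) left (2 ℕ.+ k) (tighten k))
        (λ { ((vx′ , t , top , below , p , p∈ , tight) , _) → t , (λ { zero → get top ; (suc i) → vx′ i }) ,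
          record { below = λ q∈ → proj₂ (below (reverse⁺ q∈)) ; pivot = p ; pivot∈ = p∈ ; tight = tight } })
        (Loop.each-wp (pos , suc k) (pos′ , suc k) left (positive (bound ∷ rows)) (Tightest (bound ∷ rows) x)
          (λ ()) id id (tighten-only k) (λ { (inj₁ ()) ; (inj₂ ()) }) (λ { (inj₁ ()) ; (inj₂ ()) })
          (λ {past} {σ} {σ′} s (vx , t , (ts , top) , rest) →
            xE-resp k {σ} {σ′} (λ j _ → s (var unknown , j) (unknown∉ j)) vx , t , (ts , trans (s (var unknown , k) (unknown∉ k)) top) , rest)
          tighten-wp len
          (trans (s (pos , suc k) λ { (inj₁ ()) ; (inj₂ ()) }) eq)
          (xE-resp k {σ} {σ₁} (λ j lt → s (var unknown , j) λ { (inj₁ refl) → ℕ.<-irrefl refl lt }) vx , 0# , (_ , e) , (λ ()) ,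
            -- Before the first iteration the tight row is `bound`, at the value 0.
            bound , ∈-filter⁺ (λ p → ¬? (head p ≤? 0#)) (here refl) (λ h → 0≢1 (≤-antisym 0≤1 h)) , affine-bound (0# ◂ x)))
      where
      unknown∉ : ∀ {k} j → ¬ Cursor (pos , suc k) (pos′ , suc k) left 0 (var unknown , j)
      unknown∉ j (inj₂ (inj₁ ()))
      unknown∉ j (inj₂ (inj₂ (_ , _ , ())))

    backward-wp : ∀ k {s} (rows : List (Row k)) {σ} → length rows ℕ.≤ s → capacity k s ℕ.≤ L →
      Chain k rows σ → positive (final k rows) ≡ [] →
      WP (backward k) (λ σ′ → ∃[ x ] Vals σ′ (xE k) x × Best k rows x) σ
    backward-wp zero    rows len cap ch none = wp-skip ((λ ()) , (λ ()) , λ {p} → best-zero rows (λ ()) none {p})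
    backward-wp (suc k) {s} rows {σ} len cap ((p , _) , ch) none =
      wp-then (backward k) (minimise k) (backward-only k)
        (backward-wp k (eliminate (bound ∷ rows)) (length-eliminate rows len) (ℕ.≤-trans (ℕ.m≤n+m _ (suc s ℕ.* suc (suc k))) cap) ch none)
        λ (x , vx , best) same → wp-map (minimise k) (λ (t , v , lb) → (t ◂ x) , v , best-suc k rows best lb)
          (minimise-wp rows x vx (trans (same (pos , suc k) ℕ.1+n≰n) p)
            (fits k (bound ∷ rows) (positive (bound ∷ rows)) (length-positive (bound ∷ rows)) (s≤s len) cap))

-- The relaxation as an elimination problem

module LinearProgram {a ℓ} (F : OrderedField a ℓ) {n : ℕ}
  (S : Over.Polytope F n) (α : OrderedField.Carrier F) where

  open OrderedField F renaming (Carrier to K)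
  open Over F
  open FieldProperties F
  open FourierMotzkin F
  open Machine F
  open Elimination F
  open Polytope S

  -- One variable for each generator and one for the objective. The number depends on the polytope
  -- alone and not on the instance.
  D : ℕ
  D = suc size

  budgetRow : Vector K (suc n) → Row D
  budgetRow r = (λ i → - 1# * (front r · generator i)) ▹ 0# ▹ - α * end r

  costRow : Vector K n → Row D
  costRow c = (λ i → - 1# * (c · generator i)) ▹ 1# ▹ 0#

  massRow massRow′ : Row D
  massRow  = (λ _ → - 1#) ▹ 0# ▹ - 1#
  massRow′ = (λ _ → 1#) ▹ 0# ▹ 1#

  inputRows : UnweightedInstance n → List (Vector K (suc n))
  inputRows I = tabulate λ i → A i ▹ b i
    where open UnweightedInstance I

  -- The variables are the negated weights of the generators, followed by a
  -- lower bound on the negated cost. Maximising the latter under the sign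
  -- constraints of the elimination minimises the cost.
  rowsFrom : Vector K n → List (Vector K (suc n)) → List (Row D)
  rowsFrom c rs = map budgetRow rs ++ costRow c ∷ massRow′ ∷ massRow ∷ []

  programRows : Instance n → List (Row D)
  programRows I = rowsFrom cost (reverse (inputRows unweighted))
    where open Instance I

  weights : Vector K D → Vector K size
  weights x i = - 1# * front x i

  solution : Vector K D → Vector K n
  solution x j = weights x · (λ i → generator i j)

  affine-▹▹ : ∀ (f : Vector K size) v c x → affine (f ▹ v ▹ c) x ≡ f · front x + v * end x + c
  affine-▹▹ f v c x = trans (affine-▹ (f ▹ v) c x) (cong (_+ c) (▹-· f v x))

  -1*-1* : ∀ x → - 1# * (- 1# * x) ≡ x
  -1*-1* x = solve 1 (λ x → :- :1 :* (:- :1 :* x) := x) refl x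

  scaled-front : ∀ (f : Vector K size) x → (λ i → - 1# * f i) · front x ≡ weights x · f
  scaled-front f x = sum-cong-≗ (λ i → solve 2 (λ f x → (:- :1 :* f) :* x := (:- :1 :* x) :* f) refl (f i) (front x i))

  at-solution : ∀ f x → f · solution x ≡ weights x · (λ i → f · generator i)
  at-solution f x = ·-combination f (weights x) generator

  affine-budget : ∀ r x → affine (budgetRow r) x ≡ front r · solution x - α * end r
  affine-budget r x = begin
    affine (budgetRow r) x                                  ≡⟨ affine-▹▹ _ _ _ x ⟩
    (λ i → - 1# * (front r · generator i)) · front x + 0# * end x + - α * end r
      ≡⟨ cong (λ t → t + 0# * end x + - α * end r) (trans (scaled-front (λ i → front r · generator i) x) (sym (at-solution (front r) x))) ⟩
    front r · solution x + 0# * end x + - α * end r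
      ≡⟨ solve 4 (λ s e α b → s :+ :0 :* e :+ :- α :* b := s :- α :* b) refl (front r · solution x) (end x) α (end r) ⟩
    front r · solution x - α * end r ∎
    where open ≡-Reasoning

  affine-cost : ∀ c x → affine (costRow c) x ≡ c · solution x + end x
  affine-cost c x = begin
    affine (costRow c) x ≡⟨ affine-▹▹ _ _ _ x ⟩
    (λ i → - 1# * (c · generator i)) · front x + 1# * end x + 0#
      ≡⟨ cong (λ t → t + 1# * end x + 0#) (trans (scaled-front (λ i → c · generator i) x) (sym (at-solution c x))) ⟩
    c · solution x + 1# * end x + 0#
      ≡⟨ solve 2 (λ s e → s :+ :1 :* e :+ :0 := s :+ e) refl (c · solution x) (end x) ⟩
    c · solution x + end x ∎
    where open ≡-Reasoning

  affine-mass : ∀ x → affine massRow x ≡ sum (weights x) - 1#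
  affine-mass x = trans (affine-▹▹ _ _ _ x)
    (solve 2 (λ s e → s :+ :0 :* e :+ :- :1 := s :- :1) refl (sum (weights x)) (end x))

  affine-mass′ : ∀ x → affine massRow′ x ≡ 1# - sum (weights x)
  affine-mass′ x = begin
    affine massRow′ x                           ≡⟨ affine-▹▹ _ _ _ x ⟩
    (λ _ → 1#) · front x + 0# * end x + 1#      ≡⟨ cong (λ t → t + 0# * end x + 1#) (begin
        (λ _ → 1#) · front x                    ≡⟨ sum-cong-≗ (λ i → solve 1 (λ x → :1 :* x := :- :1 :* (:- :1 :* x)) refl (front x i)) ⟩
        (λ _ → - 1#) · weights x                ≡⟨ *-distribˡ-sum (- 1#) (weights x) ⟨
        - 1# * sum (weights x)                  ∎) ⟩
    - 1# * sum (weights x) + 0# * end x + 1#    ≡⟨ solve 2 (λ s e → :- :1 :* s :+ :0 :* e :+ :1 := :1 :- s) refl (sum (weights x)) (end x) ⟩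
    1# - sum (weights x)                        ∎
    where open ≡-Reasoning

  -≤0⇒≤ : ∀ {x y} → x - y ≤ 0# → x ≤ y
  -≤0⇒≤ {x} {y} h = by-diff _ (≤0⇒0≤- h) (solve 2 (λ x y → y :- x := :- (x :- y)) refl x y)

  ≤⇒-≤0 : ∀ {x y} → x ≤ y → x - y ≤ 0#
  ≤⇒-≤0 {x} {y} h = by-diff _ (≤⇒0≤- h) (solve 2 (λ x y → :0 :- (x :- y) := y :- x) refl x y)

  module _ (I : Instance n) where
    open Instance I

    budgetRow∈ : ∀ i → budgetRow (A i ▹ b i) ∈ₗ programRows I
    budgetRow∈ i = ∈-++⁺ˡ (∈-map⁺ budgetRow (reverse⁺ (∈-tabulate⁺ i)))

    static∈ : ∀ {p} → p ∈ₗ costRow cost ∷ massRow′ ∷ massRow ∷ [] → p ∈ₗ programRows I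
    static∈ = ∈-++⁺ʳ (map budgetRow (reverse (inputRows unweighted)))

    front-A : ∀ i y → front (A i ▹ b i) · y ≡ A i · y
    front-A i y = ·-cong {u = y} (front-▹ (A i) (b i)) (λ _ → refl)

    affine-A : ∀ i x → affine (budgetRow (A i ▹ b i)) x ≡ A i · solution x - α * b i
    affine-A i x = trans (affine-budget (A i ▹ b i) x) (cong₂ (λ s t → s - α * t) (front-A i (solution x)) (end-▹ (A i) (b i)))

    solution-feasible : ∀ {x} → NonPos x → Sat (programRows I) x → Feasible S unweighted α (solution x)
    solution-feasible {x} np sat =
      (weights x , (λ i → subst (0# ≤_) (solve 1 (λ x → :- x := :- :1 :* x) refl (front x i)) (≤0⇒0≤- (front-nonPos x np i))) ,
        ≤-antisym (-≤0⇒≤ (subst (_≤ 0#) (affine-mass x) (sat (static∈ (there (there (here refl)))))))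
                  (-≤0⇒≤ (subst (_≤ 0#) (affine-mass′ x) (sat (static∈ (there (here refl)))))) ,
        (λ j → refl)) ,
      (λ i → -≤0⇒≤ (subst (_≤ 0#) (affine-A i x) (sat (budgetRow∈ i))))
      where
      front-nonPos : ∀ {k} (x : Vector K (suc k)) → NonPos x → ∀ i → front x i ≤ 0#
      front-nonPos x np zero    = np zero
      front-nonPos x np (suc i) = front-nonPos (tail x) (np ∘ suc) i

    solution-cost : ∀ {x} → Sat (programRows I) x → cost · solution x ≤ - end x
    solution-cost {x} sat = -≤0⇒≤ (subst (_≤ 0#)
      (trans (affine-cost cost x) (solve 2 (λ s e → s :+ e := s :- :- e) refl (cost · solution x) (end x)))
      (sat (static∈ (here refl))))

    module _ (S≥0 : ∀ x → x ∈ S → NonNeg x) {y} (y-feasible : Feasible S unweighted α y) where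

      private
        w   = proj₁ (proj₁ y-feasible)
        w≥0 = proj₁ (proj₂ (proj₁ y-feasible))
        w≡1 = proj₁ (proj₂ (proj₂ (proj₁ y-feasible)))
        y≡  = proj₂ (proj₂ (proj₂ (proj₁ y-feasible)))
        Ay≤ = proj₂ y-feasible

      point : Vector K D
      point = (λ i → - 1# * w i) ▹ - (cost · y)

      weights-point : ∀ i → weights point i ≡ w i
      weights-point i = trans (cong (- 1# *_) (front-▹ (λ i → - 1# * w i) (- (cost · y)) i)) (-1*-1* (w i))

      at-point : ∀ f → f · solution point ≡ f · y
      at-point f = ·-cong {x = f} (λ _ → refl)
        (λ j → trans (sum-cong-≗ (λ i → cong (_* generator i j) (weights-point i))) (sym (y≡ j)))

      -- The sign constraint on the objective variable excludes no feasible `y`: costs and points of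
      -- the polytope are nonnegative, so the negated cost is nonpositive.
      point-nonPos : NonPos point
      point-nonPos = ▹-all (_≤ 0#) (λ i → subst (_≤ 0#) (solve 1 (λ w → :- w := :- :1 :* w) refl (w i)) (0≤⇒-≤0 (w≥0 i)))
        (0≤⇒-≤0 (·-nonNeg c-nonNeg (S≥0 y (proj₁ y-feasible))))

      end-point : end point ≡ - (cost · y)
      end-point = end-▹ (λ i → - 1# * w i) (- (cost · y))

      mass-point : sum (weights point) ≡ 1#
      mass-point = trans (sum-cong-≗ weights-point) w≡1

      point-sat : Sat (programRows I) point
      point-sat p∈ with ∈-++⁻ (map budgetRow (reverse (inputRows unweighted))) p∈
      ... | inj₁ q∈ with ∈-map⁻ budgetRow q∈
      ...   | r , r∈ , refl with ∈-tabulate⁻ {f = λ i → A i ▹ b i} (reverse⁻ r∈)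
      ...     | i , refl = subst (_≤ 0#) (sym (trans (affine-A i point) (cong (_- α * b i) (at-point (A i))))) (≤⇒-≤0 (Ay≤ i))
      point-sat p∈ | inj₂ (here refl) = ≤-reflexive (begin
        affine (costRow cost) point           ≡⟨ affine-cost cost point ⟩
        cost · solution point + end point     ≡⟨ cong₂ _+_ (at-point cost) end-point ⟩
        cost · y - cost · y                   ≡⟨ -‿inverseʳ (cost · y) ⟩
        0#                                    ∎)
        where open ≡-Reasoning
      point-sat p∈ | inj₂ (there (here refl)) =
        ≤-reflexive (trans (affine-mass′ point) (trans (cong (λ t → 1# - t) mass-point) (-‿inverseʳ 1#)))
      point-sat p∈ | inj₂ (there (there (here refl))) =
        ≤-reflexive (trans (affine-mass point) (trans (cong (_- 1#) mass-point) (-‿inverseʳ 1#)))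

      best-optimal : ∀ {x} → IsBest (programRows I) x → cost · solution x ≤ cost · y
      best-optimal {x} best = ≤-trans (solution-cost (IsBest.sat best)) (by-diff _
        (≤⇒0≤- (IsBest.maximal best point point-nonPos point-sat))
        (trans (solve 2 (λ c e → c :- :- e := e :- :- c) refl (cost · y) (end x)) (cong (λ t → end x - t) (sym end-point))))

  -- The relaxation as a program, with the polytope and α compiled in as constants

  dotE : ∀ {k} → Vector Expr k → Vector K k → Expr
  dotE {zero}  e g = lit 0#
  dotE {suc k} e g = op add (op mul (head e) (lit (head g))) (dotE (tail e) (tail g))

  dot-val : ∀ {k σ} {e : Vector Expr k} {x} g → Vals σ e x → Val σ (dotE e g) (x · g)
  dot-val {zero}  g v = lit
  dot-val {suc k} g v = op (op (v zero) lit mul) (dot-val (tail g) (v ∘ suc)) add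

  front-vals : ∀ {k σ} {e : Vector Expr (suc k)} {x} → Vals σ e x → Vals σ (front e) (front x)
  front-vals v zero    = v zero
  front-vals v (suc i) = front-vals (v ∘ suc) i

  end-val : ∀ {k σ} {e : Vector Expr (suc k)} {x} → Vals σ e x → Val σ (end e) (end x)
  end-val {zero}  v = v zero
  end-val {suc k} v = end-val (v ∘ suc)

  budgetE costE massE massE′ : Vector Expr (suc D)
  budgetE = (λ i → op mul (lit (- 1#)) (dotE (front (block left)) (generator i))) ▹ lit 0# ▹ op mul (lit (- α)) (end {n = n} (block left))
  costE   = (λ i → op mul (lit (- 1#)) (dotE (block left) (generator i))) ▹ lit 1# ▹ lit 0#
  massE   = (λ _ → lit (- 1#)) ▹ lit 0# ▹ lit (- 1#)
  massE′  = (λ _ → lit 1#) ▹ lit 0# ▹ lit 1#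

  solutionE : Vector Expr n
  solutionE j = dotE (λ i → op mul (lit (- 1#)) (front (xE D) i)) (λ i → generator i j)

  ▹▹-vals : ∀ {k σ} {f : Vector Expr k} {f′ : Vector K k} {v v′ c c′} → Vals σ f f′ → Val σ v v′ → Val σ c c′ →
    Vals σ (f ▹ v ▹ c) (f′ ▹ v′ ▹ c′)
  ▹▹-vals {σ = σ} hf hv hc = ▹-zip (Val σ) (▹-zip (Val σ) hf hv) hc

  budget-vals : ∀ {σ r} → Vals σ (block left) r → Vals σ budgetE (budgetRow r)
  budget-vals v = ▹▹-vals (λ i → op lit (dot-val (generator i) (front-vals v)) mul) lit (op lit (end-val v) mul)

  cost-vals : ∀ {σ c} → Vals σ (block left) c → Vals σ costE (costRow c)
  cost-vals v = ▹▹-vals (λ i → op lit (dot-val (generator i) v) mul) lit lit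

  solution-vals : ∀ {σ x} → Vals σ (xE D) x → Vals σ solutionE (solution x)
  solution-vals v j = dot-val (λ i → generator i j) (λ i → op lit (front-vals v i) mul)

  -- `load` takes the cost vector off the input for good, its saved copy landing on a scratch stack.
  -- Emission prepends, so the rows are produced in the reverse of the order in `rowsFrom`.
  load readBudgets readRows : Program
  load        = pop (input , 0) (tmp , 0) left 0 n
  readBudgets = traverse (input , 0) (input′ , 0) left (suc n) (emit D budgetE)
  readRows    = load ⨾ emit D massE ⨾ emit D massE′ ⨾ emit D costE ⨾ readBudgets

  opaque
    setup finish : Program
    setup  = readRows ⨾ forward D
    finish = backward D ⨾ pushes (input , 0) solutionE

  -- After elimination the tested register holds the positive constants, each of them a
  -- contradiction. If there are none, the optimal point has been put in front of the rows on the
  -- input stack, and the answer of the oracle replaces that stack.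
  solver : Program
  solver = setup ⨾ if nonEmpty (code (pos , 0)) then skip else (finish ⨾ call (code (input , 0)) (code (input , 0)))

  Reading : Reg → Set
  Reading (input , _)  = ⊤
  Reading (input′ , _) = ⊤
  Reading (tmp , _)    = ⊤
  Reading (var left , _)  = ⊤
  Reading (pos , j)    = j ≡ D
  Reading (neg , j)    = j ≡ D
  Reading _            = ⊥

  readRows-only : Only Reading readRows
  readRows-only = only-mono (cursor⊆ Reading tt tt (λ _ → tt)) load (pop-only (input , 0) (tmp , 0) left 0 n) ,
    emits massE , emits massE′ , emits costE ,
    traverse-only (input , 0) (input′ , 0) left (suc n) (emit D budgetE) (cursor⊆ Reading tt tt (λ _ → tt)) (emits budgetE)
    where
    emits : ∀ es → Only Reading (emit D es)
    emits es = only-mono (emission⊆ Reading refl refl (λ _ → tt)) (emit D es) (emit-only D es)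

  encode-rows : ∀ (I : UnweightedInstance n) x → encode x I ≡ tabulate x ++ flatten (inputRows I)
  encode-rows I x = cong (λ rs → tabulate x ++ concat rs) (sym (trans (map-tabulate (λ i → A i ▹ b i) tabulate)
    (tabulate-cong (λ i → tabulate-▹ (A i) (b i)))))
    where open UnweightedInstance I

  length-encode : ∀ (I : UnweightedInstance n) x → length (encode x I) ≡ n ℕ.+ length (flatten (inputRows I))
  length-encode I x = trans (cong length (encode-rows I x)) (trans (length-++ (tabulate x)) (cong (ℕ._+ _) (length-tabulate x)))

  length-rows≤ : ∀ (I : UnweightedInstance n) x → length (flatten (inputRows I)) ℕ.≤ length (encode x I)
  length-rows≤ I x = subst (length (flatten (inputRows I)) ℕ.≤_) (sym (length-encode I x)) (ℕ.m≤n+m _ n)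

  length-programRows : ∀ I → let open Instance I in length (programRows I) ℕ.≤ length (encode cost unweighted) ℕ.+ 3
  length-programRows I = begin
    length (programRows I)                                    ≡⟨ length-++ (map budgetRow (reverse rs)) ⟩
    length (map budgetRow (reverse rs)) ℕ.+ 3                 ≡⟨ cong (ℕ._+ 3) (trans (length-map budgetRow (reverse rs)) (length-reverse rs)) ⟩
    length rs ℕ.+ 3                                           ≤⟨ ℕ.+-monoˡ-≤ 3 (ℕ.m≤m*n (length rs) (suc n)) ⟩
    length rs ℕ.* suc n ℕ.+ 3                                 ≡⟨ cong (ℕ._+ 3) (length-flatten rs) ⟨
    length (flatten rs) ℕ.+ 3                                 ≤⟨ ℕ.+-monoˡ-≤ 3 (length-rows≤ unweighted cost) ⟩
    length (encode cost unweighted) ℕ.+ 3                     ∎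
    where
    open Instance I
    open ℕ.≤-Reasoning
    rs = inputRows unweighted

  module _ (O : Oracle) (L : ℕ) (I : Instance n) where

    open Instance I
    open WeakestPrecondition O L
    open Rules O L

    readRows-wp : ∀ {σ} → σ at (input , 0) ≡ encode cost unweighted → (∀ r → r ≢ (input , 0) → σ at r ≡ []) →
      length (encode cost unweighted) ℕ.≤ L →
      WP readRows (λ σ′ → Holds D (programRows I) σ′ × σ′ at (input , 0) ≡ flatten (inputRows unweighted)) σ
    readRows-wp {σ} eq clean len =
      wp-then load _ (pop-only (input , 0) (tmp , 0) left 0 n)
        (pop-wp {row = cost} (input , 0) (tmp , 0) left 0 (λ ()) id id (trans eq (encode-rows unweighted cost)))
        λ {σ₁} (in₁ , _ , tops) s₁ →
      wp-then (emit D massE) _ (emit-only D massE)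
        (emit-wp D {massE} {massRow} {[]} (▹▹-vals (λ _ → lit) lit lit)
          (trans (s₁ (pos , D) λ { (inj₁ ()) ; (inj₂ (inj₁ ())) ; (inj₂ (inj₂ (_ , _ , ()))) }) (clean (pos , D) λ ()) ,
           trans (s₁ (neg , D) λ { (inj₁ ()) ; (inj₂ (inj₁ ())) ; (inj₂ (inj₂ (_ , _ , ()))) }) (clean (neg , D) λ ())))
        λ {σ₂} l₂ s₂ →
      wp-then (emit D massE′) _ (emit-only D massE′) (emit-wp D {massE′} {massRow′} (▹▹-vals (λ _ → lit) lit lit) l₂)
        λ {σ₃} l₃ s₃ →
      wp-then (emit D costE) readBudgets (emit-only D costE)
        (emit-wp D {costE} {costRow cost} (cost-vals (λ i → val-resp {σ₁}
          (λ b j → trans (s₃ (var b , j) (unemitted b j)) (s₂ (var b , j) (unemitted b j))) (get {b = left} {i = toℕ i} (tops i)))) l₃)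
        λ {σ₄} l₄ s₄ →
      wp-map readBudgets (λ (l , e , _) → l , e)
        (Loop.traverse-wp (input , 0) (input′ , 0) left (inputRows unweighted) (λ past → Holds D (rowsFrom cost past))
          (λ ()) id id (emit-only D budgetE) (λ { (inj₁ ()) ; (inj₂ (inj₁ ())) ; (inj₂ (inj₂ ())) }) (λ { (inj₁ ()) ; (inj₂ (inj₁ ())) ; (inj₂ (inj₂ ())) })
          (λ {past} {σ} {σ′} s → holds-resp {D} (rowsFrom cost past) {σ} {σ′}
            (s (pos , D) λ { (inj₁ ()) ; (inj₂ (inj₁ ())) ; (inj₂ (inj₂ (_ , _ , ()))) })
            (s (neg , D) λ { (inj₁ ()) ; (inj₂ (inj₁ ())) ; (inj₂ (inj₂ (_ , _ , ()))) }))
          (λ {past} {row} _ v l → emit-wp D {budgetE} {budgetRow row} (budget-vals v) l)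
          (ℕ.≤-trans (length-rows≤ unweighted cost) len)
          (trans (s₄ (input , 0) unwritten) (trans (s₃ (input , 0) unwritten) (trans (s₂ (input , 0) unwritten) in₁)))
          (trans (s₄ (input′ , 0) unwritten′) (trans (s₃ (input′ , 0) unwritten′) (trans (s₂ (input′ , 0) unwritten′)
            (trans (s₁ (input′ , 0) λ { (inj₁ ()) ; (inj₂ (inj₁ ())) ; (inj₂ (inj₂ (_ , _ , ()))) }) (clean (input′ , 0) λ ())))))
          l₄)
      where
      unemitted : ∀ b j → ¬ Emission D (var b , j)
      unemitted b j (inj₁ ())
      unemitted b j (inj₂ (inj₁ ()))
      unemitted b j (inj₂ (inj₂ ()))
      unwritten : ¬ Emission D (input , 0)
      unwritten (inj₁ ())
      unwritten (inj₂ (inj₁ ()))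
      unwritten (inj₂ (inj₂ ()))
      unwritten′ : ¬ Emission D (input′ , 0)
      unwritten′ (inj₁ ())
      unwritten′ (inj₂ (inj₁ ()))
      unwritten′ (inj₂ (inj₂ ()))

    opaque
      unfolding setup

      setup-wp : ∀ {σ} → σ at (input , 0) ≡ encode cost unweighted → (∀ r → r ≢ (input , 0) → σ at r ≡ []) →
        length (encode cost unweighted) ℕ.≤ L → capacity D (length (encode cost unweighted) ℕ.+ 3) ℕ.≤ L →
        WP setup (λ σ′ → Chain D (programRows I) σ′ × σ′ at (input , 0) ≡ flatten (inputRows unweighted)) σ
      setup-wp {σ} eq clean len cap =
        wp-then readRows (forward D) readRows-only (readRows-wp eq clean len) λ {σ₁} (l , e) s →
        wp-map (forward D) (λ (ch , s′) → ch , trans (s′ (input , 0) id) e)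
          (wp-frame (forward D) (forward-only D) (forward-wp O L D (programRows I) (length-programRows I) cap l
            ((λ j _ → trans (s (pos′ , j) id) (clean (pos′ , j) λ ()) , trans (s (neg′ , j) id) (clean (neg′ , j) λ ())) ,
             (λ j j<D → trans (s (pos , j) (ℕ.<⇒≢ j<D)) (clean (pos , j) λ ()) , trans (s (neg , j) (ℕ.<⇒≢ j<D)) (clean (neg , j) λ ())))))

      -- The rows have stayed on the input stack since `load` removed the cost vector. Pushing the
      -- solution onto them therefore yields the encoding that the rounding algorithm expects.
      finish-wp : ∀ {σ} → Chain D (programRows I) σ → positive (final D (programRows I)) ≡ [] →
        σ at (input , 0) ≡ flatten (inputRows unweighted) → capacity D (length (encode cost unweighted) ℕ.+ 3) ℕ.≤ L →
        WP finish (λ σ′ → ∃[ x ] IsBest (programRows I) x × σ′ at (input , 0) ≡ encode (solution x) unweighted) σ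
      finish-wp ch none eq cap =
        wp-then (backward D) _ (backward-only D) (backward-wp O L D (programRows I) (length-programRows I) cap ch none)
          λ (x , v , best) s → wp-map (pushes (input , 0) solutionE)
            (λ e → x , best , trans e (trans (cong (tabulate (solution x) ++_) (trans (s (input , 0) id) eq)) (sym (encode-rows unweighted (solution x)))))
            (pushes-wp (input , 0) (id , id) (solution-vals v))

-- Polynomial running time

-- With `suc s` as base the powers increase with the exponent even at size 0, so sums and products
-- need no case distinction.
PolynomiallyBounded : (ℕ → ℕ) → Set
PolynomiallyBounded f = ∃[ C ] ∃[ d ] ∀ s → f s ℕ.≤ C ℕ.* suc s ℕ.^ d

module _ where
  open import Data.Nat.Base using (_+_; _*_; _^_; _≤_)
  open ℕ.≤-Reasoning

  poly-const : ∀ c → PolynomiallyBounded (λ _ → c)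
  poly-const c = c , 0 , λ _ → ℕ.≤-reflexive (sym (ℕ.*-identityʳ c))

  poly-id : PolynomiallyBounded (λ s → s)
  poly-id = 1 , 1 , λ s → ℕ.≤-trans (ℕ.n≤1+n s) (ℕ.≤-reflexive (sym (trans (ℕ.*-identityˡ _) (ℕ.*-identityʳ (suc s)))))

  poly-+ : ∀ {f g} → PolynomiallyBounded f → PolynomiallyBounded g → PolynomiallyBounded (λ s → f s + g s)
  poly-+ {f} {g} (C , d , f≤) (C′ , d′ , g≤) = C + C′ , d + d′ , λ s → begin
    f s + g s                                       ≤⟨ ℕ.+-mono-≤ (f≤ s) (g≤ s) ⟩
    C * suc s ^ d + C′ * suc s ^ d′                 ≤⟨ ℕ.+-mono-≤ (ℕ.*-monoʳ-≤ C (ℕ.^-monoʳ-≤ (suc s) (ℕ.m≤m+n d d′))) (ℕ.*-monoʳ-≤ C′ (ℕ.^-monoʳ-≤ (suc s) (ℕ.m≤n+m d′ d))) ⟩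
    C * suc s ^ (d + d′) + C′ * suc s ^ (d + d′)    ≡⟨ ℕ.*-distribʳ-+ (suc s ^ (d + d′)) C C′ ⟨
    (C + C′) * suc s ^ (d + d′)                     ∎

  poly-* : ∀ {f g} → PolynomiallyBounded f → PolynomiallyBounded g → PolynomiallyBounded (λ s → f s * g s)
  poly-* {f} {g} (C , d , f≤) (C′ , d′ , g≤) = C * C′ , d + d′ , λ s → begin
    f s * g s                                ≤⟨ ℕ.*-mono-≤ (f≤ s) (g≤ s) ⟩
    (C * suc s ^ d) * (C′ * suc s ^ d′)      ≡⟨ ℕ.[m*n]*[o*p]≡[m*o]*[n*p] C (suc s ^ d) C′ (suc s ^ d′) ⟩
    C * C′ * (suc s ^ d * suc s ^ d′)        ≡⟨ cong (C * C′ *_) (ℕ.^-distribˡ-+-* (suc s) d d′) ⟨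
    C * C′ * suc s ^ (d + d′)                ∎

  poly-^ : ∀ {f} d → PolynomiallyBounded f → PolynomiallyBounded (λ s → f s ^ d)
  poly-^ zero    p = poly-const 1
  poly-^ (suc d) p = poly-* p (poly-^ d p)

  ^-distribʳ-* : ∀ d m n → (m * n) ^ d ≡ m ^ d * n ^ d
  ^-distribʳ-* zero    m n = refl
  ^-distribʳ-* (suc d) m n = trans (cong (m * n *_) (^-distribʳ-* d m n)) (ℕ.[m*n]*[o*p]≡[m*o]*[n*p] m n (m ^ d) (n ^ d))

  -- For a positive size s + 1 is at most 2 s; the additive constant takes care of size 0.
  suc^≤ : ∀ d s → suc s ^ d ≤ 2 ^ d * s ^ d + 2 ^ d
  suc^≤ d zero    = begin
    1 ^ d                      ≡⟨ ℕ.^-zeroˡ d ⟩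
    1                          ≤⟨ ℕ.m^n>0 2 d ⟩
    2 ^ d                      ≤⟨ ℕ.m≤n+m (2 ^ d) (2 ^ d * 0 ^ d) ⟩
    2 ^ d * 0 ^ d + 2 ^ d      ∎
  suc^≤ d (suc s) = begin
    suc (suc s) ^ d                    ≤⟨ ℕ.^-monoˡ-≤ d (s≤s (ℕ.≤-trans (s≤s (ℕ.m≤m+n s (s + 0))) (ℕ.≤-reflexive (sym (ℕ.+-suc s (s + 0)))))) ⟩
    (2 * suc s) ^ d                    ≡⟨ ^-distribʳ-* d 2 (suc s) ⟩
    2 ^ d * suc s ^ d                  ≤⟨ ℕ.m≤m+n _ _ ⟩
    2 ^ d * suc s ^ d + 2 ^ d          ∎

  poly⇒bound : ∀ {f} → PolynomiallyBounded f → ∃[ C ] ∃[ d ] ∀ s → f s ≤ C * s ^ d + C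
  poly⇒bound {f} (C , d , f≤) = C * 2 ^ d , d , λ s → begin
    f s                                    ≤⟨ f≤ s ⟩
    C * suc s ^ d                          ≤⟨ ℕ.*-monoʳ-≤ C (suc^≤ d s) ⟩
    C * (2 ^ d * s ^ d + 2 ^ d)            ≡⟨ ℕ.*-distribˡ-+ C (2 ^ d * s ^ d) (2 ^ d) ⟩
    C * (2 ^ d * s ^ d) + C * 2 ^ d        ≡⟨ cong (_+ C * 2 ^ d) (ℕ.*-assoc C (2 ^ d) (s ^ d)) ⟨
    C * 2 ^ d * s ^ d + C * 2 ^ d          ∎

  -- Every eliminated variable squares the number of rows. The exponent is exponential in `k`, but
  -- `k` is a constant.
  capacity-poly : ∀ k {f} → PolynomiallyBounded f → PolynomiallyBounded (λ s → capacity k (f s))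
  capacity-poly zero    p = p
  capacity-poly (suc k) p = poly-+ (poly-* q (poly-const (suc (suc k)))) (capacity-poly k (poly-* q q))
    where q = poly-+ (poly-const 1) p

module _ {a ℓ} (F : OrderedField a ℓ) where
  open Over F
  open Machine F

  maxTime-poly : ∀ {L} → PolynomiallyBounded L → ∀ p → PolynomiallyBounded (λ s → maxTime (L s) p)
  maxTime-poly l skip                 = poly-const 1
  maxTime-poly l (p ⨾ q)              = poly-+ (maxTime-poly l p) (maxTime-poly l q)
  maxTime-poly l (push r x)           = poly-const 1
  maxTime-poly l (drop r)             = poly-const 1
  maxTime-poly l (copy r s)           = poly-const 1
  maxTime-poly l (arith o r s u)      = poly-const 1
  maxTime-poly l (if c then p else q) = poly-+ (poly-const 1) (poly-+ (maxTime-poly l p) (maxTime-poly l q))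
  maxTime-poly l (while c loop p)     = poly-+ (poly-const 1) (poly-* l (poly-+ (poly-const 1) (maxTime-poly l p)))
  maxTime-poly l (call r s)           = poly-const 1

  -- The summand 3 counts the cost row and the two mass rows; the final `s` covers the loops that
  -- read the input.
  iterations : ℕ → ℕ → ℕ
  iterations k s = capacity k (s ℕ.+ 3) ℕ.+ s

  -- Setup, the branch, the back-substitution, and the call with the time spent inside the oracle.
  -- The latter is bounded in the same `s`, since the point to be rounded has as many entries as the
  -- cost vector it replaces.
  runTime : (p q : Program) (k C d n : ℕ) → ℕ → ℕ
  runTime p q k C d n s =
    maxTime (iterations k s) p ℕ.+ (1 ℕ.+ (maxTime (iterations k s) q ℕ.+ (1 ℕ.+ s ℕ.+ polyBound C d s ℕ.+ n)))

  runTime-poly : ∀ p q k C d n → PolynomiallyBounded (runTime p q k C d n)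
  runTime-poly p q k C d n = poly-+ (maxTime-poly iterations-poly p) (poly-+ (poly-const 1) (poly-+ (maxTime-poly iterations-poly q)
    (poly-+ (poly-+ (poly-+ (poly-const 1) poly-id) (poly-+ (poly-* (poly-const C) (poly-^ d poly-id)) (poly-const C))) (poly-const n))))
    where
    iterations-poly : PolynomiallyBounded (iterations k)
    iterations-poly = poly-+ (capacity-poly k (poly-+ poly-id (poly-const 3))) poly-id

-- The approximation algorithm

module _ {a ℓ} (F : OrderedField a ℓ) where

  open OrderedField F renaming (Carrier to K)
  open Over F
  open FieldProperties F
  open FourierMotzkin F using (positive; final; final-sound; IsBest)
  open Machine F
  open Elimination F using (Chain; chain-final)
  open Rounding F using (rounding-cost)

  module _ {n} (S : Polytope n) (S≥0 : ∀ x → x ∈ S → NonNeg x) {α β : K} (1≤α : 1# ≤ α) (0≤β : 0# ≤ β)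
    (𝒜 : Program) (rounds : IsFPRA S α β 𝒜) where

    open LinearProgram F S α

    time : ℕ → ℕ
    time = runTime F setup finish D (proj₁ rounds) (proj₁ (proj₂ rounds)) n

    module _ (I : Instance n) where

      open Instance I

      data-in = encode cost unweighted
      size-in = length data-in

      initial : Store
      initial = (λ _ → []) [ 0 ≔ data-in ]

      initial-input : initial at (input , 0) ≡ data-in
      initial-input = trans (cong initial code-input) (≔-at (λ _ → []) 0)

      initial-clean : ∀ r → r ≢ (input , 0) → initial at r ≡ []
      initial-clean r n = ≔-other (λ _ → []) (λ e → n (code-injective (sym (trans code-input e))))

      α-feasible : ∀ {y} → Feasible S unweighted 1# y → Feasible S unweighted α y
      α-feasible (y∈S , Ay≤) = y∈S , λ i → ≤-trans (Ay≤ i) (by-diff _ (*-nonNeg (≤⇒0≤- 1≤α) (b-nonNeg i))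
        (solve 2 (λ α b → α :* b :- :1 :* b := (α :- :1) :* b) refl α (b i)))

      -- The optimal value for the budgets b is attained at some `y`, and the rounded point costs no
      -- more than any such `y`.
      rounded-approximation : ∀ {x x̂} → IsBest (programRows I) x → IsRounding S α β unweighted (solution x) x̂ →
        IsApproximation S 1# (α * β) I x̂
      rounded-approximation {x} {x̂} best R = record
        { extreme = extreme
        ; cost≤   = λ { v ((y , y-feasible , cy≡v) , _) → subst (cost · x̂ ≤_) (trans cy≡v (sym (*-identityˡ v)))
                        (rounding-cost S S≥0 1≤α I feasible (λ y f → best-optimal I S≥0 f best) R y y-feasible) }
        ; budget  = λ i → ≤-trans (P2 i) (subst (β * (A i · solution x) ≤_)
                        (solve 3 (λ α β b → β :* (α :* b) := α :* β :* b) refl α β (b i)) (*-monoˡ-≤ 0≤β (proj₂ feasible i)))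
        }
        where
        open IsRounding R
        feasible = solution-feasible I (IsBest.nonPos best) (IsBest.sat best)

      Outcome : Set _
      Outcome = ∃[ out ] ∃[ t ] ∃[ k ] Run (asOracle 𝒜) solver data-in out t k × t ℕ.≤ time size-in × k ℕ.≤ 1 ×
        (∃ (Feasible S unweighted 1#) → k ≡ 1 × (∃[ x̂ ] out ≡ tabulate x̂ × IsApproximation S 1# (α * β) I x̂))

      L = iterations F D size-in

      -- As α ≥ 1, a point within the budgets b is also within α b. Infeasibility of the relaxation
      -- thus rules out any feasible point, and halting without a call is permitted.
      rejected : ∀ {σ₁ t₁ p ps} → Exec (asOracle 𝒜) setup initial σ₁ t₁ 0 → t₁ ℕ.≤ maxTime L setup →
        Chain D (programRows I) σ₁ → positive (final D (programRows I)) ≡ p ∷ ps → Outcome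
      rejected {σ₁} {t₁} {p} {ps} ex₁ t₁≤ chain infeasible = σ₁ 0 , _ , _ ,
        (σ₁ , seq ex₁ (if-true (cons (trans (chain-final D chain) (cong flatten infeasible))) skip) , refl) ,
        ℕ.+-mono-≤ t₁≤ (s≤s (ℕ.≤-trans (s≤s z≤n) (ℕ.m≤n+m _ (maxTime L finish)))) , z≤n ,
        λ (y , y-feasible) → ⊥-elim (absurd (trans (sym infeasible) (final-sound D (programRows I)
          (point I S≥0 (α-feasible y-feasible)) (point-nonPos I S≥0 (α-feasible y-feasible)) (point-sat I S≥0 (α-feasible y-feasible)))))
        where
        absurd : p ∷ ps ≡ [] → ⊥
        absurd ()

      accepted : ∀ {σ₁ t₁ σ₂ t₂ x} → Exec (asOracle 𝒜) setup initial σ₁ t₁ 0 → t₁ ℕ.≤ maxTime L setup →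
        Chain D (programRows I) σ₁ → positive (final D (programRows I)) ≡ [] →
        Exec (asOracle 𝒜) finish σ₁ σ₂ t₂ 0 → t₂ ℕ.≤ maxTime L finish →
        IsBest (programRows I) x → σ₂ at (input , 0) ≡ encode (solution x) unweighted → Outcome
      accepted {σ₁} {t₁} {σ₂} {t₂} {x} ex₁ t₁≤ chain feasible ex₂ t₂≤ best in₂ = tabulate x̂ , _ , _ ,
        (_ , seq ex₁ (if-false (empty (trans (chain-final D chain) (cong flatten feasible)))
               (seq ex₂ (call (subst (λ xs → asOracle 𝒜 xs (tabulate x̂) t₃) (sym in₂) run)))) ,
           trans (cong (σ₂ [ code (input , 0) ≔ tabulate x̂ ]) (sym code-input)) (≔-at σ₂ (code (input , 0)))) ,
        ℕ.+-mono-≤ t₁≤ (s≤s (ℕ.+-mono-≤ t₂≤ (ℕ.+-mono-≤ (s≤s (ℕ.+-mono-≤ (ℕ.≤-reflexive (trans (cong length in₂) len))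
          (subst (λ s → t₃ ℕ.≤ polyBound C d s) len t₃≤))) (ℕ.≤-reflexive (length-tabulate x̂))))) , ℕ.≤-refl ,
        λ _ → refl , x̂ , refl , rounded-approximation best R
        where
        C = proj₁ rounds
        d = proj₁ (proj₂ rounds)
        rounding = proj₂ (proj₂ rounds) unweighted (solution x) (proj₁ (solution-feasible I (IsBest.nonPos best) (IsBest.sat best)))
        x̂   = proj₁ rounding
        t₃  = proj₁ (proj₂ rounding)
        run = proj₁ (proj₂ (proj₂ rounding))
        t₃≤ = proj₁ (proj₂ (proj₂ (proj₂ rounding)))
        R   = proj₂ (proj₂ (proj₂ (proj₂ rounding)))
        len : length (encode (solution x) unweighted) ≡ size-in
        len = trans (length-encode unweighted (solution x)) (sym (length-encode unweighted cost))

      outcome : Outcome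
      outcome =
        let σ₁ , t₁ , ex₁ , t₁≤ , chain , in₁ = setup-wp (asOracle 𝒜) L I initial-input initial-clean
              (ℕ.m≤n+m size-in _) (ℕ.m≤m+n (capacity D (size-in ℕ.+ 3)) size-in)
        in continue ex₁ t₁≤ chain in₁ (positive (final D (programRows I))) refl
        where
        continue : ∀ {σ₁ t₁} → Exec (asOracle 𝒜) setup initial σ₁ t₁ 0 → t₁ ℕ.≤ maxTime L setup → Chain D (programRows I) σ₁ →
          σ₁ at (input , 0) ≡ flatten (inputRows unweighted) → ∀ ps → positive (final D (programRows I)) ≡ ps → Outcome
        continue ex₁ t₁≤ chain in₁ (p ∷ ps) infeasible = rejected ex₁ t₁≤ chain infeasible
        continue ex₁ t₁≤ chain in₁ []       feasible   =
          let σ₂ , t₂ , ex₂ , t₂≤ , x , best , in₂ = finish-wp (asOracle 𝒜) L I chain feasible in₁ (ℕ.m≤m+n (capacity D (size-in ℕ.+ 3)) size-in)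
          in accepted ex₁ t₁≤ chain feasible ex₂ t₂≤ best in₂

    solver-approximates : IsSingleCallApproximationAlgorithm S 1# (α * β) 𝒜 solver
    solver-approximates = proj₁ bounded , proj₁ (proj₂ bounded) , λ I → let out , t , k , run , t≤ , rest = outcome I in
      out , t , k , run , ℕ.≤-trans t≤ (proj₂ (proj₂ bounded) _) , rest
      where bounded = poly⇒bound (runTime-poly F setup finish D (proj₁ rounds) (proj₁ (proj₂ rounds)) n)

theorem9 : ∀ {a ℓ} (F : OrderedField a ℓ) → let open OrderedField F in let open Over F in
    ∀ {n : ℕ} (P : Polytope n) → (∀ x → x ∈ P → NonNeg x) →
    ∀ (α β : Carrier) → 1# ≤ α → 0# ≤ β →
    ∀ (𝒜 : Program) → IsFPRA P α β 𝒜 →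
    ∃[ ℬ ] IsSingleCallApproximationAlgorithm P 1# (α * β) 𝒜 ℬ
theorem9 F S S≥0 α β 1≤α 0≤β 𝒜 rounds = _ , solver-approximates F S S≥0 1≤α 0≤β 𝒜 rounds
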